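{- Fix a real number $d>4$. Let $G$ be a finite group of order $n$, let $S$ be a random sequence of density $d$ in $G$ (that is, of length $k=d\log_2 n$, with entries drawn independently and uniformly from $G$), and let the hash functions $\eta:G\to\mathcal{C}$ used by the Pollard-$\rho$ short product algorithm described in the context be random oracles. Then for almost all $S$ (that is, with probability over the choice of $S$ tending to $1$ as $n\to\infty$), for every target $z\in\pi(\mathcal{P}(S))$, the Pollard-$\rho$ algorithm on input $(S,z)$ outputs a subsequence of $S$ whose product is $z$ using an expected number $O(\sqrt{n}\,\log n)$ of group operations and storage for $O(1)$ group elements. Here the expectation is over the random choices made by the algorithm (the elements $w$ and the random oracles $\eta$), and the implied constants depend only on $d$.
   Context: **Computational model.** $G$ is a finite group of order $n$, written multiplicatively, given as a generic (black-box) group: elements have unique identifiers, and multiplication, inversion, and generation of random elements are performed by a black box. Time is the number of group operations (black-box calls); space is the number of group elements simultaneously stored. Evaluating a hash function is not counted as a group operation and its description is not counted in the storage. Bit-strings of length $O(\log n)$ (in particular, elements of the set $\mathcal{C}$ below) count as $O(1)$ group elements of storage. **Notation.** For a finite sequence $S$ in $G$ of length $k$, its density is $d=k/\log_2 n$ (rounding $k$ to an integer is ignored). $\mathcal{P}(S)$ is the set of all subsequences of $S$, represented by subsets of the index set $\{1,\dots,k\}$ (so there are $2^k$ of them). For a sequence $y=(y_1,\dots,y_m)$ of elements of $G$, $\pi(y)=y_1y_2\cdots y_m\in G$ is its ordered product (the empty product being the identity), and $\mu(y)=(y_m^{ -1},\dots,y_1^{ -1})$. Write $S=AB$ as the concatenation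 of two sequences $A$ and $B$ of roughly equal length (lengths differing by at most one). Given $z\in G$, put $\mathcal{A}=\mathcal{P}(A)$ and $\mathcal{B}=\{z\mu(y): y\in\mathcal{P}(B)\}$, where $z\mu(y)$ is the sequence $(z,y_m^{ -1},\dots,y_1^{ -1})$ and the elements of $\mathcal{B}$ are again indexed by $y\in\mathcal{P}(B)$. Let $\mathcal{C}=\mathcal{A}\sqcup\mathcal{B}$ be the disjoint union; $\pi$ is also regarded as a map $\mathcal{C}\to G$. A random oracle $\eta:G\to\mathcal{C}$ is a function drawn uniformly at random from the set of all functions $G\to\mathcal{C}$. For such $\eta$, put $\phi=\eta\circ\pi:\mathcal{C}\to\mathcal{C}$, and let $\phi^{(i)}$ denote its $i$-fold iterate. **Pollard-$\rho$ algorithm.** Input: a finite sequence $S$ in $G$ and a target $z\in\pi(\mathcal{P}(S))$. Output: a subsequence of $S$ whose product is $z$. 1. Pick a random element $w\in\mathcal{C}$ and a hash function $\eta:G\to\mathcal{C}$ (here: a fresh random oracle each time this step is executed). 2. Find the least $i>0$ and $j\ge 0$ such that $\phi^{(i+j)}(w)=\phi^{(j)}(w)$ (using, for example, Floyd's cycle-finding algorithm, which stores only two elements of $\mathcal{C}$ at a time). 3. If $j=0$, return to Step 1. 4. Let $s=\phi^{(i+j-1)}(w)$ and $t=\phi^{(j-1)}(w)$. 5. If $\pi(s)\ne\pi(t)$, return to Step 1. 6. If $s\in\mathcal{A}$ and $t=z\mu(y)\in\mathcal{B}$, output the concatenation $sy$ and terminate. 7. If $t\in\mathcal{A}$ and $s=z\mu(y)\in\mathcal{B}$,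 output the concatenation $ty$ and terminate. 8. Return to Step 1. -}

module Defs where

open import Level using (Level; _⊔_) renaming (suc to lsuc)
open import Algebra.Bundles using (Group)
open import Data.Bool.Base using (if_then_else_)
open import Data.Bool.Properties using () renaming (_≟_ to _≟ᵇ_)
import Data.Fin.Base as Fin
open Fin using (Fin; fromℕ<)
import Data.Fin.Properties as Fin
open import Data.Fin.Subset using (Subset; inside; outside)
open import Data.Integer.Base using (+_)
open import Data.List.Base as List
  using (List; []; _∷_; _++_; map; foldr; length; cartesianProduct; cartesianProductWith)
open import Data.List.Relation.Unary.All using (All)
open import Data.List.Relation.Binary.Sublist.Propositional using (_⊆_)
open import Data.Nat.Base using (ℕ; zero; suc; _+_; _*_; _^_; _≤_; _<_)
open import Data.Nat.ListAction using (sum)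
open import Data.Nat.Logarithm using (⌊log₂_⌋; ⌈log₂_⌉)
open import Data.Nat.Properties using (_<?_)
open import Data.Product.Base using (_×_; _,_; ∃; ∃-syntax; ∃₂; proj₁; proj₂; map₁)
open import Data.Rational.Base as ℚ using (ℚ)
open import Data.Sum.Base using (_⊎_; inj₁; inj₂)
import Data.Sum.Properties as Sum
open import Data.Vec.Base as Vec using (Vec; []; _∷_; lookup; take; drop)
import Data.Vec.Properties as Vec
open import Function.Bundles using (Inverse; _⇔_)
open import Relation.Binary.Definitions using (DecidableEquality)
open import Relation.Binary.PropositionalEquality using (_≡_; setoid)
open import Relation.Nullary using (¬_; does; yes; no)

------------------------------------------------------------------------
-- Real numbers, as Dedekind cuts

record ℝ : Set₁ where
  field
    lower upper : ℚ → Set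
    lower-inhabited : ∃ lower
    upper-inhabited : ∃ upper
    lower-rounded : ∀ q → lower q ⇔ (∃[ r ] q ℚ.< r × lower r)
    upper-rounded : ∀ q → upper q ⇔ (∃[ r ] r ℚ.< q × upper r)
    disjoint : ∀ q → ¬ (lower q × upper q)
    located : ∀ p q → p ℚ.< q → lower p ⊎ upper q

_<ᵣ_ : ℚ → ℝ → Set
q <ᵣ d = ℝ.lower d q

_ᵣ<_ : ℝ → ℚ → Set
d ᵣ< q = ℝ.upper d q

-- For d > 0 and n ≥ 1:  ∣ k - d log₂ n ∣ < 1, i.e. k is d log₂ n rounded
-- to an integer in one direction or the other.  For a rational r = p / q
-- (q > 0),
--   k - 1 < r log₂ n  ⇔  2 ^ (k q) < 2 ^ q n ^ p   and
--   r log₂ n < k + 1  ⇔  n ^ p < 2 ^ ((k + 1) q).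
_≈_log₂_ : ℕ → ℝ → ℕ → Set
k ≈ d log₂ n =
    (∃₂ λ p q → ((+ p) ℚ./ suc q) <ᵣ d × 2 ^ (k * suc q) < 2 ^ suc q * n ^ p)
  × (∃₂ λ p q → d ᵣ< ((+ p) ℚ./ suc q) × n ^ p < 2 ^ (suc k * suc q))

------------------------------------------------------------------------
-- Uniform probability on finite sets
--
-- A finite sample space is a list having each outcome exactly once.

private variable
  ℓ₁ ℓ₂ : Level
  X : Set ℓ₁
  m : ℕ

vectors : List X → (m : ℕ) → List (Vec X m)
vectors xs zero    = [] ∷ []
vectors xs (suc m) = cartesianProductWith _∷_ xs (vectors xs m)

subsets : (m : ℕ) → List (Subset m)
subsets = vectors (outside ∷ inside ∷ [])

-- "P has probability at least 1 - 1 / (1 + e) on the sample space Ω".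
-- P need not be decidable, so this asks for an event of that probability
-- all of whose outcomes satisfy P.
HoldsUpTo1/1+ : ℕ → (Ω : List X) → (X → Set ℓ₂) → Set _
HoldsUpTo1/1+ e Ω P =
  ∃[ E ] E ⊆ Ω × All P E × e * length Ω ≤ suc e * length E

------------------------------------------------------------------------
-- Finite groups with unique identifiers

record FiniteGroup (c ℓ : Level) (n : ℕ) : Set (lsuc (c ⊔ ℓ)) where
  field
    group       : Group c ℓ
    enumeration : Inverse (setoid (Fin n)) (Group.setoid group)
  open Group group public

  identifier : Carrier → Fin n
  identifier = Inverse.from enumeration

  elements : List Carrier
  elements = List.tabulate (Inverse.to enumeration)

module Products {c ℓ} (G : Group c ℓ) where
  open Group G using (Carrier; _∙_; ε)

  π : List Carrier → Carrier
  π = foldr _∙_ ε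

  subsequence : ∀ {k} → Vec Carrier k → Subset k → List Carrier
  subsequence []      []            = []
  subsequence (g ∷ S) (inside  ∷ u) = g ∷ subsequence S u
  subsequence (_ ∷ S) (outside ∷ u) = subsequence S u

ProductIn : ∀ {c ℓ n k} (G : FiniteGroup c ℓ n) →
            Vec (FiniteGroup.Carrier G) k → FiniteGroup.Carrier G → Set ℓ
ProductIn G S z = ∃[ u ] π (subsequence S u) ≈ z
  where open FiniteGroup G using (_≈_; group)
        open Products group

syntax ProductIn G S z = z ∈π𝒫[ G ] S

------------------------------------------------------------------------
-- The set 𝒞: inj₁ x stands for x ∈ 𝒫(A), inj₂ y for the sequence
-- z μ(y) = (z , yₘ⁻¹ , … , y₁⁻¹) with y = (y₁ , … , yₘ) ∈ 𝒫(B)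

𝒞 : ℕ → ℕ → Set
𝒞 a b = Subset a ⊎ Subset b

𝒞-elements : ∀ a b → List (𝒞 a b)
𝒞-elements a b = map inj₁ (subsets a) ++ map inj₂ (subsets b)

-- A function from the group elements, given by their identifiers, to 𝒞.
Oracle : ℕ → ℕ → ℕ → Set
Oracle n a b = Vec (𝒞 a b) n

-- The random choices (w , η) made at the start of a round.
Draw : ℕ → ℕ → ℕ → Set
Draw n a b = 𝒞 a b × Oracle n a b

draws : ∀ n a b → List (Draw n a b)
draws n a b = cartesianProduct (𝒞-elements a b) (vectors (𝒞-elements a b) n)

------------------------------------------------------------------------
-- Computations counted by number of black-box calls

Counted : Set ℓ₁ → Set ℓ₁
Counted X = ℕ × X

return : X → Counted X
return x = 0 , x

_>>=_ : {Y : Set ℓ₂} → Counted X → (X → Counted Y) → Counted Y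
(k , x) >>= f = map₁ (λ j → k + j) (f x)

------------------------------------------------------------------------
-- The Pollard-ρ algorithm, as a machine that makes at most one black-box
-- call per step.  The input A, B, z, and the hash function η, are
-- read-only and are not part of a configuration; everything else the
-- machine remembers is.

module Pollard {c ℓ} {n} (G : FiniteGroup c ℓ n) {a b : ℕ}
               (A : Vec (FiniteGroup.Carrier G) a)
               (B : Vec (FiniteGroup.Carrier G) b)
               (z : FiniteGroup.Carrier G) where

  open FiniteGroup G using (Carrier; _∙_; _⁻¹; ε; identifier)

  C : Set
  C = 𝒞 a b

  _≟_ : DecidableEquality C
  _≟_ = Sum.≡-dec (Vec.≡-dec _≟ᵇ_) (Vec.≡-dec _≟ᵇ_)

  -- The two black-box operations.
  mul : Carrier → Carrier → Counted Carrier
  mul g h = 1 , g ∙ h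

  inv : Carrier → Counted Carrier
  inv g = 1 , g ⁻¹

  _⟨_⟩ : Oracle n a b → Carrier → C
  η ⟨ g ⟩ = lookup η (identifier g)

  -- What is remembered while π(v), v ∈ 𝒞, is being computed.  Below,
  -- φ = η ∘ π.
  data Frame : Set c where
    -- Floyd's algorithm, meeting phase: (x , y) := (φ x , φ (φ y)) until
    -- x ≡ y, starting from x = y = w.
    tortoise  : (w y : C) → Frame                        -- v = x
    hare₁     : (w x : C) → Frame                        -- v = y
    hare₂     : (w x : C) → Frame                        -- v = φ y
    -- Computing j: (x , y) := (φ x , φ y) until x ≡ y, starting from
    -- x = w and the y of the meeting phase.
    tail₁     : (w y : C) (j : ℕ) → Frame                -- v = x
    tail₂     : (w x : C) (j : ℕ) → Frame                -- v = y
    -- Computing i: y := φ y until y ≡ x, starting from y = x = φ⁽ʲ⁾(w).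
    cycle     : (w x : C) (j i : ℕ) → Frame              -- v = y
    -- Iterating φ to reach t, resp. s: r applications remain after this one.
    advance-t : (i r : ℕ) → Frame
    advance-s : (t : C) (r : ℕ) → Frame
    -- Comparing π(s) with π(t).
    value-s   : (t : C) → Frame                          -- v = s
    value-t   : (s : C) (πs : Carrier) → Frame           -- v = t

  data Config : Set c where
    restart  : Config
    -- evaluate κ v p g: the first p positions of v have been processed,
    -- giving the partial product g.
    evaluate : Frame → C → ℕ → Carrier → Config
    -- multiply κ v p g h: as before, and h is the inverse of entry p of B.
    multiply : Frame → C → ℕ → Carrier → Carrier → Config
    output   : Subset (a + b) → Config

  call : Frame → C → Config
  call κ v = evaluate κ v 0 ε

  meet : (w x y : C) → Config
  findTail : (w x y : C) (j : ℕ) → Config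
  findCycle : (w x y : C) (j i : ℕ) → Config
  restartOrFind : (w : C) (i j : ℕ) → Config
  find-t : (i r : ℕ) (t : C) → Config
  find-s : (t : C) (r : ℕ) (s : C) → Config
  decide : (s t : C) → Config

  meet w x y = if does (x ≟ y) then findTail w w y 0 else call (tortoise w y) x

  findTail w x y j =
    if does (x ≟ y) then call (cycle w x j 0) x else call (tail₁ w y j) x

  findCycle w x y j i =
    if does (y ≟ x) then restartOrFind w i j else call (cycle w x j i) y

  -- If j > 0, then t = φ⁽ʲ⁻¹⁾(w) and s = φ⁽ⁱ⁾(t).
  restartOrFind w i zero    = restart
  restartOrFind w i (suc j) = find-t i j w

  find-t i zero    t = find-s t i t
  find-t i (suc r) t = call (advance-t i r) t

  find-s t zero    s = call (value-s t) s
  find-s t (suc r) s = call (advance-s t r) s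

  decide (inj₁ x) (inj₂ y) = output (x Vec.++ y)
  decide (inj₂ y) (inj₁ x) = output (x Vec.++ y)
  decide _        _        = restart

  -- Continue after π(v) has been found to be g.
  resume : Oracle n a b → Frame → (v : C) (g : Carrier) → Config
  resume η (tortoise w y)  _ g = call (hare₁ w (η ⟨ g ⟩)) y
  resume η (hare₁ w x)     _ g = call (hare₂ w x) (η ⟨ g ⟩)
  resume η (hare₂ w x)     _ g = meet w x (η ⟨ g ⟩)
  resume η (tail₁ w y j)   _ g = call (tail₂ w (η ⟨ g ⟩) j) y
  resume η (tail₂ w x j)   _ g = findTail w x (η ⟨ g ⟩) (suc j)
  resume η (cycle w x j i) _ g = findCycle w x (η ⟨ g ⟩) j (suc i)
  resume η (advance-t i r) _ g = find-t i r (η ⟨ g ⟩)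
  resume η (advance-s t r) _ g = find-s t r (η ⟨ g ⟩)
  resume η (value-s t)     s g = call (value-t s g) t
  resume η (value-t s πs)  t g =
    if does (identifier πs Fin.≟ identifier g) then decide s t else restart

  -- One step within a round.  π(x) is accumulated from the left, and
  -- π(z μ(y)) = z ∙ (yₘ⁻¹ ∙ (⋯ ∙ y₁⁻¹)) from the right.
  step : Oracle n a b → Config → Counted Config
  step η (evaluate κ (inj₁ x) p g) with p <? a
  ... | no  _   = return (resume η κ (inj₁ x) g)
  ... | yes p<a with lookup x (fromℕ< p<a)
  ...   | outside = return (evaluate κ (inj₁ x) (suc p) g)
  ...   | inside  = do
          g′ ← mul g (lookup A (fromℕ< p<a))
          return (evaluate κ (inj₁ x) (suc p) g′)
  step η (evaluate κ (inj₂ y) p g) with p <? b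
  ... | no  _   = do
          g′ ← mul z g
          return (resume η κ (inj₂ y) g′)
  ... | yes p<b with lookup y (fromℕ< p<b)
  ...   | outside = return (evaluate κ (inj₂ y) (suc p) g)
  ...   | inside  = do
          h ← inv (lookup B (fromℕ< p<b))
          return (multiply κ (inj₂ y) p g h)
  step η (multiply κ v p g h) = do
    g′ ← mul h g
    return (evaluate κ v (suc p) g′)
  step η C@restart    = return C
  step η C@(output _) = return C

  -- The first (at most) t steps, using the given draws for the successive
  -- rounds, and waiting in restart once these are used up.
  mutual
    run : ∀ {m} → ℕ → Vec (Draw n a b) m → Counted Config
    run zero    _              = return restart
    run (suc t) []             = return restart
    run (suc t) ((w , η) ∷ ds) = continue t ds η (call (tortoise w w) w)

    continue : ∀ {m} → ℕ → Vec (Draw n a b) m → Oracle n a b → Config →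
               Counted Config
    continue t       ds η restart = run t ds
    continue zero    ds η C       = return C
    continue (suc t) ds η C       = do
      C′ ← step η C
      continue t ds η C′

  operations : ∀ {m} → ℕ → Vec (Draw n a b) m → ℕ
  operations t ds = proj₁ (run t ds)

  configuration : ∀ {m} → ℕ → Vec (Draw n a b) m → Config
  configuration t ds = proj₂ (run t ds)

  -- Storage in bits, a stored group element counting as ⌈log₂ n⌉ bits.

  ∣element∣ : ℕ
  ∣element∣ = ⌈log₂ n ⌉

  ∣_∣ᶜ : C → ℕ
  ∣ inj₁ _ ∣ᶜ = suc a
  ∣ inj₂ _ ∣ᶜ = suc b

  ∣_∣ⁿ : ℕ → ℕ
  ∣ i ∣ⁿ = ⌈log₂ suc i ⌉

  frameStorage : Frame → ℕ
  frameStorage (tortoise w y)  = ∣ w ∣ᶜ + ∣ y ∣ᶜ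
  frameStorage (hare₁ w x)     = ∣ w ∣ᶜ + ∣ x ∣ᶜ
  frameStorage (hare₂ w x)     = ∣ w ∣ᶜ + ∣ x ∣ᶜ
  frameStorage (tail₁ w y j)   = ∣ w ∣ᶜ + ∣ y ∣ᶜ + ∣ j ∣ⁿ
  frameStorage (tail₂ w x j)   = ∣ w ∣ᶜ + ∣ x ∣ᶜ + ∣ j ∣ⁿ
  frameStorage (cycle w x j i) = ∣ w ∣ᶜ + ∣ x ∣ᶜ + ∣ j ∣ⁿ + ∣ i ∣ⁿ
  frameStorage (advance-t i r) = ∣ i ∣ⁿ + ∣ r ∣ⁿ
  frameStorage (advance-s t r) = ∣ t ∣ᶜ + ∣ r ∣ⁿ
  frameStorage (value-s t)     = ∣ t ∣ᶜ
  frameStorage (value-t s _)   = ∣ s ∣ᶜ + ∣element∣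

  storage : Config → ℕ
  storage restart              = 0
  storage (evaluate κ v p _)   = frameStorage κ + ∣ v ∣ᶜ + ∣ p ∣ⁿ + ∣element∣
  storage (multiply κ v p _ _) =
    frameStorage κ + ∣ v ∣ᶜ + ∣ p ∣ⁿ + ∣element∣ + ∣element∣
  storage (output u)           = a + b

------------------------------------------------------------------------
-- On input (S , z), where S = A B with A of length a and B of length b,
-- the algorithm is correct, takes at most κ √n log₂ n expected group
-- operations and stores at most σ group elements.

record PollardSolves {c ℓ n} (κ σ : ℕ) (G : FiniteGroup c ℓ n) (a b : ℕ)
                     (S : Vec (FiniteGroup.Carrier G) (a + b))
                     (z : FiniteGroup.Carrier G) : Set (c ⊔ ℓ) where
  open FiniteGroup G using (_≈_; group)
  open Products group
  open Pollard G (take a S) (drop a S) z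

  Outcomes : (m : ℕ) → List (Vec (Draw n a b) m)
  Outcomes = vectors (draws n a b)

  field
    correct : ∀ {m} t (ds : Vec (Draw n a b) m) u →
              configuration t ds ≡ output u → π (subsequence S u) ≈ z

    -- Output is produced with probability 1.
    terminates : ∀ e → ∃₂ λ m t →
                 HoldsUpTo1/1+ e (Outcomes m)
                   (λ ds → ∃[ u ] configuration t ds ≡ output u)

    -- The expected total number of operations is the supremum over m and t
    -- of the expected number in the first t steps with m draws.  The bound
    -- on the latter is squared so as to avoid √n, and is multiplied by
    -- the size of the sample space.
    time : ∀ m t →
           sum (map (operations t) (Outcomes m)) ^ 2
             ≤ (κ * ⌊log₂ n ⌋ * length (Outcomes m)) ^ 2 * n

    space : ∀ {m} t (ds : Vec (Draw n a b) m) →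
            storage (configuration t ds) ≤ σ * ⌈log₂ n ⌉

{-# OPTIONS --safe #-}

-- For independent uniform A, distinct subsequences of A have independent
-- products.  So the number of representations of g as a subproduct of A has
-- variance at most 2ᵃ / n, and by Chebyshev's inequality, as 2ᵃ is much larger
-- than n² (this is d > 4), for almost all A every g ∈ G has between ½ and
-- 3⁄2 times the expected number 2ᵃ / n of representations; and likewise for B.
-- Fix such A and B.  With lazy sampling of η, the elements w , φ w , φ (φ w) , …
-- are independent and uniform on 𝒞 until the first time that a group element
-- π (φ⁽ⁱ⁾ w) repeats.  At each time, each group element already seen recurs
-- with probability at least 1 / 2 n, so that the expected time of the first
-- repetition is O(√n); and given that there is one, with probability at least
-- 1 / 7 its two occurrences come from opposite halves of 𝒞, in which case they
-- are the s and t of the algorithm and the round succeeds.  Floyd's algorithm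
-- takes linearly many evaluations of φ in that time, with O(log n) group
-- operations each, and the number of rounds is geometrically distributed.

module Submission where

open import Defs
import Algebra.Properties.Group as GroupProperties
open import Data.Bool.Base using (Bool; true; false; if_then_else_; not; _∧_; _∨_)
open import Data.Bool.ListAction using (any)
open import Data.Bool.Properties using (∧-zeroʳ; ∧-identityʳ)
open import Data.Fin.Base using (Fin; zero; suc; fromℕ<; toℕ)
import Data.Fin.Properties as Fin
open import Data.Fin.Subset using (Subset; inside; outside)
open import Data.List.Base as List
  using (List; []; _∷_; _++_; map; length; tabulate; applyDownFrom; cartesianProductWith; filter)
open import Data.List.Properties using (length-map; length-++; length-tabulate; map-++; map-∘)
open import Data.List.Relation.Binary.Sublist.Propositional.Properties using (filter-⊆)
open import Data.List.Relation.Unary.All as All using (All)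
open import Data.List.Relation.Unary.All.Properties using (all-filter)
open import Data.Nat.Base as ℕ hiding (_/_)
open import Data.Nat.DivMod using (m≡m%n+[m/n]*n; m%n<n)
open import Data.Nat.ListAction using (sum)
open import Data.Nat.ListAction.Properties using (sum-++)
open import Data.Nat.Logarithm
open import Data.Nat.Properties hiding (_≟_)
open import Data.Nat.Tactic.RingSolver using (solve-∀)
open import Data.Product.Base using (_×_; _,_; ∃-syntax; ∃₂; proj₁; proj₂)
open import Data.Sum.Base using (_⊎_; inj₁; inj₂; [_,_]′)
open import Data.Unit.Base using (⊤)
open import Data.Vec.Base as Vec using (Vec; []; _∷_; lookup; take; drop; _[_]≔_)
open import Data.Vec.Properties using (lookup∘update′)
open import Function.Base using (_∘_)
open import Function.Bundles using (Equivalence; Inverse; mk⇔)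
import Level
open import Relation.Binary.Definitions using (tri<; tri≈; tri>)
open import Relation.Binary.PropositionalEquality
open import Relation.Nullary using (¬_; Dec; does; yes; no; contradiction)
open import Relation.Nullary.Decidable using (map′; does-⇔; dec-true; dec-false; _×-dec_)
open import Relation.Unary using (Decidable)

-- Finite sums

-- Every probability is a count: an expectation is a sum over a list of outcomes, inequalities are
-- multiplied by the size of the sample space, and subtracted terms are moved to the other side. In
-- place of √n stands an integer s with n ≤ s² ≤ 4 n.
--
-- The obstacle is that the random walk and the machine follow different objects. The walk stops at
-- the first repeated label in G, which is what independence controls; the machine searches for
-- equalities in 𝒞 along the orbit of φ. The shape of the orbit joins the two: distinct elements
-- with the same label have the same image, so the cycle is entered one step later, and they are
-- exactly the two predecessors that the machine compares.
--
-- Regularity concerns A and B alone. The target merely inverts and translates the products of B, so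
-- that one exceptional set of sequences serves for all z.
--
-- The machine is analysed once per draw, by a derivation of `Run`, from which correctness, storage,
-- the number of operations and termination are all read off.

module _ {ℓ} {X : Set ℓ} where

  ∑ : List X → (X → ℕ) → ℕ
  ∑ xs f = sum (map f xs)

  infixr 8 ∑
  syntax ∑ xs (λ x → e) = ∑[ x ∈ xs ] e

  ∑-cong : ∀ xs {f g : X → ℕ} → (∀ x → f x ≡ g x) → ∑ xs f ≡ ∑ xs g
  ∑-cong []       f≡g = refl
  ∑-cong (x ∷ xs) f≡g = cong₂ _+_ (f≡g x) (∑-cong xs f≡g)

  ∑-mono : ∀ xs {f g : X → ℕ} → (∀ x → f x ≤ g x) → ∑ xs f ≤ ∑ xs g
  ∑-mono []       f≤g = z≤n
  ∑-mono (x ∷ xs) f≤g = +-mono-≤ (f≤g x) (∑-mono xs f≤g)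

  ∑-+ : ∀ xs (f g : X → ℕ) → ∑[ x ∈ xs ] (f x + g x) ≡ ∑ xs f + ∑ xs g
  ∑-+ []       f g = refl
  ∑-+ (x ∷ xs) f g = trans (cong (f x + g x +_) (∑-+ xs f g)) (swap (f x) (g x) (∑ xs f) (∑ xs g))
    where
    swap : ∀ p q r s → p + q + (r + s) ≡ p + r + (q + s)
    swap = solve-∀

  ∑-*ˡ : ∀ k xs (f : X → ℕ) → ∑[ x ∈ xs ] (k * f x) ≡ k * ∑ xs f
  ∑-*ˡ k []       f = sym (*-zeroʳ k)
  ∑-*ˡ k (x ∷ xs) f = trans (cong (k * f x +_) (∑-*ˡ k xs f)) (sym (*-distribˡ-+ k (f x) (∑ xs f)))

  ∑-*ʳ : ∀ k xs (f : X → ℕ) → ∑[ x ∈ xs ] (f x * k) ≡ ∑ xs f * k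
  ∑-*ʳ k []       f = refl
  ∑-*ʳ k (x ∷ xs) f = trans (cong (f x * k +_) (∑-*ʳ k xs f)) (sym (*-distribʳ-+ k (f x) (∑ xs f)))

  ∑-const : ∀ (xs : List X) k → ∑[ _ ∈ xs ] k ≡ length xs * k
  ∑-const []       k = refl
  ∑-const (x ∷ xs) k = cong (k +_) (∑-const xs k)

  ∑-++ : ∀ xs ys (f : X → ℕ) → ∑ (xs ++ ys) f ≡ ∑ xs f + ∑ ys f
  ∑-++ xs ys f = trans (cong sum (map-++ f xs ys)) (sum-++ (map f xs) (map f ys))

module _ {ℓ₁ ℓ₂} {X : Set ℓ₁} {Y : Set ℓ₂} where

  ∑-map : ∀ (h : X → Y) xs (f : Y → ℕ) → ∑ (map h xs) f ≡ ∑[ x ∈ xs ] f (h x)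
  ∑-map h xs f = cong sum (sym (map-∘ xs))

module _ {ℓ₁ ℓ₂} {X : Set ℓ₁} {Y : Set ℓ₂} where

  ∑-swap : ∀ xs ys (f : X → Y → ℕ) →
           ∑[ x ∈ xs ] ∑[ y ∈ ys ] f x y ≡ ∑[ y ∈ ys ] ∑[ x ∈ xs ] f x y
  ∑-swap []       ys f = sym (trans (∑-const ys 0) (*-zeroʳ (length ys)))
  ∑-swap (x ∷ xs) ys f =
    trans (cong (∑ ys (f x) +_) (∑-swap xs ys f)) (sym (∑-+ ys (f x) (λ y → ∑[ x ∈ xs ] f x y)))

  ∑-cartesianProductWith : ∀ {ℓ₃} {Z : Set ℓ₃} (h : X → Y → Z) xs ys (f : Z → ℕ) →
    ∑ (cartesianProductWith h xs ys) f ≡ ∑[ x ∈ xs ] ∑[ y ∈ ys ] f (h x y)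
  ∑-cartesianProductWith h []       ys f = refl
  ∑-cartesianProductWith h (x ∷ xs) ys f =
    trans (∑-++ (map (h x) ys) _ f)
          (cong₂ _+_ (∑-map (h x) ys f) (∑-cartesianProductWith h xs ys f))

  length-cartesianProductWith : ∀ {ℓ₃} {Z : Set ℓ₃} (h : X → Y → Z) xs ys →
    length (cartesianProductWith h xs ys) ≡ length xs * length ys
  length-cartesianProductWith h xs ys = begin
    length (cartesianProductWith h xs ys)                ≡⟨ *-identityʳ _ ⟨
    length (cartesianProductWith h xs ys) * 1            ≡⟨ ∑-const (cartesianProductWith h xs ys) 1 ⟨
    ∑[ _ ∈ cartesianProductWith h xs ys ] 1              ≡⟨ ∑-cartesianProductWith h xs ys _ ⟩
    ∑[ _ ∈ xs ] ∑[ _ ∈ ys ] 1                            ≡⟨ ∑-const xs _ ⟩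
    length xs * ∑[ _ ∈ ys ] 1
      ≡⟨ cong (length xs *_) (trans (∑-const ys 1) (*-identityʳ _)) ⟩
    length xs * length ys                                ∎
    where open ≡-Reasoning

𝟙 : Bool → ℕ
𝟙 true  = 1
𝟙 false = 0

module _ {ℓ} {X : Set ℓ} where

  ∑-vectors : ∀ (xs : List X) m (f : Vec X (suc m) → ℕ) →
              ∑ (vectors xs (suc m)) f ≡ ∑[ x ∈ xs ] ∑[ v ∈ vectors xs m ] f (x ∷ v)
  ∑-vectors xs m f = ∑-cartesianProductWith _∷_ xs (vectors xs m) f

  length-vectors : ∀ (xs : List X) m → length (vectors xs m) ≡ length xs ^ m
  length-vectors xs zero    = refl
  length-vectors xs (suc m) =
    trans (length-cartesianProductWith _∷_ xs (vectors xs m)) (cong (length xs *_) (length-vectors xs m))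

  -- The two halves of a uniform sequence are independent and uniform, so that the exceptional sets
  -- for A and for B can be estimated separately.
  ∑-vectors-+ : ∀ (xs : List X) a b (f : Vec X a → Vec X b → ℕ) →
    ∑[ S ∈ vectors xs (a + b) ] f (take a S) (drop a S) ≡
    ∑[ A ∈ vectors xs a ] ∑[ B ∈ vectors xs b ] f A B
  ∑-vectors-+ xs zero    b f = sym (+-identityʳ _)
  ∑-vectors-+ xs (suc a) b f = begin
    ∑[ S ∈ vectors xs (suc a + b) ] f (take (suc a) S) (drop (suc a) S)
      ≡⟨ ∑-vectors xs (a + b) _ ⟩
    ∑[ x ∈ xs ] ∑[ S ∈ vectors xs (a + b) ] f (x ∷ take a S) (drop a S)
      ≡⟨ ∑-cong xs (λ x → ∑-vectors-+ xs a b (λ A → f (x ∷ A))) ⟩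
    ∑[ x ∈ xs ] ∑[ A ∈ vectors xs a ] ∑[ B ∈ vectors xs b ] f (x ∷ A) B
      ≡⟨ ∑-vectors xs a _ ⟨
    ∑[ A ∈ vectors xs (suc a) ] ∑[ B ∈ vectors xs b ] f A B ∎
    where open ≡-Reasoning

  -- Markov's inequality. `bad` has only to dominate the indicator of the failure of `P`, so that a
  -- union bound can be passed as a sum; the event is the list of outcomes satisfying `P`.
  HoldsUpTo-from-bad : ∀ {ℓ′} {P : X → Set ℓ′} (P? : Decidable P) e (Ω : List X) (bad : X → ℕ) →
    (∀ x → ¬ P x → 1 ≤ bad x) → suc e * ∑ Ω bad ≤ length Ω → HoldsUpTo1/1+ e Ω P
  HoldsUpTo-from-bad {P = P} P? e Ω bad ¬P⇒bad small =
    filter P? Ω , filter-⊆ P? Ω , all-filter P? Ω , +-cancelˡ-≤ (length Ω) _ _ (begin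
      suc e * length Ω                                 ≤⟨ *-monoʳ-≤ (suc e) (covered Ω) ⟩
      suc e * (∑ Ω bad + length (filter P? Ω))         ≡⟨ *-distribˡ-+ (suc e) (∑ Ω bad) _ ⟩
      suc e * ∑ Ω bad + suc e * length (filter P? Ω)   ≤⟨ +-monoˡ-≤ _ small ⟩
      length Ω + suc e * length (filter P? Ω)          ∎)
    where
    open ≤-Reasoning
    covered : ∀ xs → length xs ≤ ∑ xs bad + length (filter P? xs)
    covered [] = z≤n
    covered (x ∷ xs) with P? x
    ... | yes _  = ≤-trans (s≤s (m≤n⇒m≤o+n (bad x) (covered xs)))
                     (≤-reflexive (trans (cong suc (sym (+-assoc (bad x) _ _))) (sym (+-suc _ _))))
    ... | no ¬Px = ≤-trans (+-mono-≤ (¬P⇒bad x ¬Px) (covered xs))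
                     (≤-reflexive (sym (+-assoc (bad x) _ _)))

-- The second moment of the number of representations

𝟙≤1 : ∀ b → 𝟙 b ≤ 1
𝟙≤1 true  = ≤-refl
𝟙≤1 false = z≤n

*-𝟙-not-≤ : ∀ {p} {P : Set p} (P? : Dec P) {k m} → (¬ P → k ≤ m) → k * 𝟙 (not (does P?)) ≤ m
*-𝟙-not-≤ (yes _) {k} _   = ≤-trans (≤-reflexive (*-zeroʳ k)) z≤n
*-𝟙-not-≤ (no ¬p) {k} k≤m = ≤-trans (≤-reflexive (*-identityʳ k)) (k≤m ¬p)

module _ {ℓ} {X : Set ℓ} where

  ∑-tabulate-zero : ∀ {n} (f : Fin n → X) (h : X → ℕ) → (∀ i → h (f i) ≡ 0) → ∑ (tabulate f) h ≡ 0
  ∑-tabulate-zero {zero}  f h h≡0 = refl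
  ∑-tabulate-zero {suc n} f h h≡0 =
    cong₂ _+_ (h≡0 zero) (∑-tabulate-zero (f ∘ suc) h (h≡0 ∘ suc))

  ∑-tabulate-single : ∀ {n} (f : Fin n → X) (h : X → ℕ) j →
    (∀ i → h (f i) ≡ 𝟙 (does (i Fin.≟ j))) → ∑ (tabulate f) h ≡ 1
  ∑-tabulate-single {suc n} f h zero    eq =
    cong₂ _+_ (eq zero) (∑-tabulate-zero (f ∘ suc) h (eq ∘ suc))
  ∑-tabulate-single {suc n} f h (suc j) eq =
    cong₂ _+_ (eq zero) (∑-tabulate-single (f ∘ suc) h j (eq ∘ suc))

  ∑-tabulate-≥ : ∀ {n} (f : Fin n → X) (h : X → ℕ) i → h (f i) ≤ ∑ (tabulate f) h
  ∑-tabulate-≥ f h zero    = m≤m+n _ _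
  ∑-tabulate-≥ f h (suc i) = m≤n⇒m≤o+n _ (∑-tabulate-≥ (f ∘ suc) h i)

∑-subsets : ∀ a (f : Subset (suc a) → ℕ) →
  ∑ (subsets (suc a)) f ≡ ∑[ u ∈ subsets a ] (f (outside ∷ u) + f (inside ∷ u))
∑-subsets a f = begin
  ∑ (subsets (suc a)) f
    ≡⟨ ∑-vectors (outside ∷ inside ∷ []) a f ⟩
  ∑ (subsets a) (f ∘ (outside ∷_)) + (∑ (subsets a) (f ∘ (inside ∷_)) + 0)
    ≡⟨ cong (∑ (subsets a) (f ∘ (outside ∷_)) +_) (+-identityʳ _) ⟩
  ∑ (subsets a) (f ∘ (outside ∷_)) + ∑ (subsets a) (f ∘ (inside ∷_))
    ≡⟨ ∑-+ (subsets a) _ _ ⟨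
  ∑[ u ∈ subsets a ] (f (outside ∷ u) + f (inside ∷ u)) ∎
  where open ≡-Reasoning

length-subsets : ∀ a → length (subsets a) ≡ 2 ^ a
length-subsets = length-vectors (outside ∷ inside ∷ [])

-- The binomial formula with the cross term on the left, which keeps the variance inside ℕ.
∣-∣²-identity : ∀ x y → ∣ x - y ∣ * ∣ x - y ∣ + 2 * (x * y) ≡ x * x + y * y
∣-∣²-identity zero    y       = +-identityʳ _
∣-∣²-identity (suc x) zero    = cong (λ t → suc x * suc x + 2 * t) (*-zeroʳ x)
∣-∣²-identity (suc x) (suc y) = begin
  D + 2 * (suc x * suc y)                ≡⟨ lemma₁ D x y ⟩
  D + 2 * (x * y) + (2 * x + 2 * y + 2)  ≡⟨ cong (_+ (2 * x + 2 * y + 2)) (∣-∣²-identity x y) ⟩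
  x * x + y * y + (2 * x + 2 * y + 2)    ≡⟨ lemma₂ x y ⟩
  suc x * suc x + suc y * suc y          ∎
  where
  open ≡-Reasoning
  D = ∣ x - y ∣ * ∣ x - y ∣
  lemma₁ : ∀ D x y → D + 2 * (suc x * suc y) ≡ D + 2 * (x * y) + (2 * x + 2 * y + 2)
  lemma₁ = solve-∀
  lemma₂ : ∀ x y → x * x + y * y + (2 * x + 2 * y + 2) ≡ suc x * suc x + suc y * suc y
  lemma₂ = solve-∀

module SecondMoment {c ℓ n} (G : FiniteGroup c ℓ n) where
  open FiniteGroup G public
    using (Carrier; _≈_; _∙_; _⁻¹; ε; identifier; elements; group; enumeration; assoc;
           ∙-congˡ; ∙-congʳ; identityˡ; identityʳ; ⁻¹-cong)
    renaming (refl to ≈-refl; reflexive to ≈-reflexive; sym to ≈-sym; trans to ≈-trans)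
  open Products group public
  open GroupProperties group using (∙-cancelʳ; \\-leftDividesˡ; \\-leftDividesʳ)
  open Inverse enumeration using (to; from; from-cong; strictlyInverseˡ; strictlyInverseʳ; to-cong)

  identifier-injective : ∀ {x y} → identifier x ≡ identifier y → x ≈ y
  identifier-injective {x} {y} eq =
    ≈-trans (≈-sym (strictlyInverseˡ x)) (≈-trans (to-cong eq) (strictlyInverseˡ y))

  infix 4 _≈?_
  _≈?_ : ∀ x y → Dec (x ≈ y)
  x ≈? y = map′ identifier-injective from-cong (identifier x Fin.≟ identifier y)

  δ : Carrier → Carrier → ℕ
  δ x y = 𝟙 (does (x ≈? y))

  δ-⇔ : ∀ {x y x′ y′} → (x ≈ y → x′ ≈ y′) → (x′ ≈ y′ → x ≈ y) → δ x y ≡ δ x′ y′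
  δ-⇔ {x} {y} {x′} {y′} f g = cong 𝟙 (does-⇔ (mk⇔ f g) (x ≈? y) (x′ ≈? y′))

  δ-yes : ∀ {x y} → x ≈ y → δ x y ≡ 1
  δ-yes {x} {y} x≈y = cong 𝟙 (dec-true (x ≈? y) x≈y)

  δ-no : ∀ {x y} → ¬ x ≈ y → δ x y ≡ 0
  δ-no {x} {y} x≉y = cong 𝟙 (dec-false (x ≈? y) x≉y)

  δ-cong : ∀ {x y x′ y′} → x ≈ x′ → y ≈ y′ → δ x y ≡ δ x′ y′
  δ-cong p q = δ-⇔ (λ r → ≈-trans (≈-sym p) (≈-trans r q)) (λ r → ≈-trans p (≈-trans r (≈-sym q)))

  ∑-δ : ∀ x → ∑[ g ∈ elements ] δ g x ≡ 1
  ∑-δ x = ∑-tabulate-single to (λ g → δ g x) (identifier x)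
    (λ i → cong (λ j → 𝟙 (does (j Fin.≟ identifier x))) (strictlyInverseʳ i))

  length-elements : length elements ≡ n
  length-elements = length-tabulate to

  ∑-δ-∙ : ∀ x y → ∑[ g ∈ elements ] δ x (y ∙ g) ≡ 1
  ∑-δ-∙ x y = trans (∑-cong elements (λ g → δ-⇔ (solve₁ g) (solve₂ g))) (∑-δ (y ⁻¹ ∙ x))
    where
    solve₁ : ∀ g → x ≈ y ∙ g → g ≈ y ⁻¹ ∙ x
    solve₁ g p = ≈-trans (≈-sym (\\-leftDividesʳ y g)) (∙-congˡ (≈-sym p))
    solve₂ : ∀ g → g ≈ y ⁻¹ ∙ x → x ≈ y ∙ g
    solve₂ g p = ≈-sym (≈-trans (∙-congˡ p) (\\-leftDividesˡ y x))

  δ-sym : ∀ x y → δ x y ≡ δ y x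
  δ-sym x y = δ-⇔ ≈-sym ≈-sym

  ∑-δ-δ : ∀ x y → ∑[ g ∈ elements ] (δ x g * δ y g) ≡ δ x y
  ∑-δ-δ x y with x ≈? y
  ... | yes x≈y = trans (∑-cong elements (λ g →
          trans (cong (_* δ y g) (δ-cong x≈y ≈-refl)) (trans (idem (does (y ≈? g))) (δ-sym y g))))
          (trans (∑-δ y) (sym (δ-yes x≈y)))
    where
    idem : ∀ b → 𝟙 b * 𝟙 b ≡ 𝟙 b
    idem true  = refl
    idem false = refl
  ... | no  x≉y = trans (∑-cong elements disjoint) (trans (∑-const elements 0)
          (trans (*-zeroʳ (length elements)) (sym (δ-no x≉y))))
    where
    disjoint : ∀ g → δ x g * δ y g ≡ 0
    disjoint g with x ≈? g
    ... | yes p = trans (cong (δ x g *_) (δ-no (λ q → x≉y (≈-trans p (≈-sym q))))) (*-zeroʳ (δ x g))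
    ... | no  p = cong (_* δ y g) (δ-no p)

  representations : ∀ {a} → Vec Carrier a → Carrier → ℕ
  representations {a} A g = ∑[ u ∈ subsets a ] δ (π (subsequence A u)) g

  representations-cong : ∀ {a} (A : Vec Carrier a) {g h} → g ≈ h →
                         representations A g ≡ representations A h
  representations-cong {a} A g≈h = ∑-cong (subsets a) (λ u → δ-cong ≈-refl g≈h)

  ∑-representations : ∀ {a} (A : Vec Carrier a) → ∑ elements (representations A) ≡ 2 ^ a
  ∑-representations {a} A = begin
    ∑[ g ∈ elements ] ∑[ u ∈ subsets a ] δ (π (subsequence A u)) g
      ≡⟨ ∑-swap elements (subsets a) _ ⟩
    ∑[ u ∈ subsets a ] ∑[ g ∈ elements ] δ (π (subsequence A u)) g
      ≡⟨ ∑-cong (subsets a) (λ u → trans (∑-cong elements (λ g → δ-sym _ g)) (∑-δ _)) ⟩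
    ∑[ u ∈ subsets a ] 1
      ≡⟨ trans (∑-const (subsets a) 1) (*-identityʳ _) ⟩
    length (subsets a)
      ≡⟨ length-subsets a ⟩
    2 ^ a ∎
    where open ≡-Reasoning

  -- The collision count of A is `pairs A ε ε`. The prefixes `x` and `y` absorb the first entry of
  -- A, which makes induction on the length possible.
  pairs : ∀ {a} → Vec Carrier a → Carrier → Carrier → ℕ
  pairs {a} A x y =
    ∑[ u ∈ subsets a ] ∑[ v ∈ subsets a ] δ (x ∙ π (subsequence A u)) (y ∙ π (subsequence A v))

  ∑-representations² : ∀ {a} (A : Vec Carrier a) →
    ∑[ g ∈ elements ] (representations A g * representations A g) ≡ pairs A ε ε
  ∑-representations² {a} A = begin
    ∑[ g ∈ elements ] (representations A g * representations A g)
      ≡⟨ ∑-cong elements (λ g → trans (sym (∑-*ʳ (representations A g) (subsets a) _))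
           (∑-cong (subsets a) (λ u → sym (∑-*ˡ (δ (p u) g) (subsets a) _)))) ⟩
    ∑[ g ∈ elements ] ∑[ u ∈ subsets a ] ∑[ v ∈ subsets a ] (δ (p u) g * δ (p v) g)
      ≡⟨ ∑-swap elements (subsets a) _ ⟩
    ∑[ u ∈ subsets a ] ∑[ g ∈ elements ] ∑[ v ∈ subsets a ] (δ (p u) g * δ (p v) g)
      ≡⟨ ∑-cong (subsets a) (λ u → ∑-swap elements (subsets a) _) ⟩
    ∑[ u ∈ subsets a ] ∑[ v ∈ subsets a ] ∑[ g ∈ elements ] (δ (p u) g * δ (p v) g)
      ≡⟨ ∑-cong (subsets a) (λ u → ∑-cong (subsets a) (λ v →
           trans (∑-δ-δ (p u) (p v)) (sym (δ-cong (identityˡ _) (identityˡ _))))) ⟩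
    pairs A ε ε ∎
    where
    open ≡-Reasoning
    p : Subset a → Carrier
    p u = π (subsequence A u)

  pairs-∷ : ∀ {a} g (A : Vec Carrier a) x y →
    pairs (g ∷ A) x y ≡ (pairs A x y + pairs A x (y ∙ g)) + (pairs A (x ∙ g) y + pairs A (x ∙ g) (y ∙ g))
  pairs-∷ {a} g A x y = begin
    pairs (g ∷ A) x y
      ≡⟨ ∑-subsets a _ ⟩
    ∑[ u ∈ subsets a ] (∑ (subsets (suc a)) (λ v → δ (x ∙ p u) (y ∙ q v))
                      + ∑ (subsets (suc a)) (λ v → δ (x ∙ (g ∙ p u)) (y ∙ q v)))
      ≡⟨ ∑-cong (subsets a) (λ u → cong₂ _+_
           (trans (split (x ∙ p u)) (∑-+ (subsets a) _ _))
           (trans (trans (∑-cong (subsets (suc a)) (λ v → δ-cong (≈-sym (assoc x g (p u))) ≈-refl))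
                         (split ((x ∙ g) ∙ p u)))
                  (∑-+ (subsets a) _ _))) ⟩
    ∑[ u ∈ subsets a ] ((row x y u + row x (y ∙ g) u) + (row (x ∙ g) y u + row (x ∙ g) (y ∙ g) u))
      ≡⟨ trans (∑-+ (subsets a) _ _) (cong₂ _+_ (∑-+ (subsets a) _ _) (∑-+ (subsets a) _ _)) ⟩
    (pairs A x y + pairs A x (y ∙ g)) + (pairs A (x ∙ g) y + pairs A (x ∙ g) (y ∙ g)) ∎
    where
    open ≡-Reasoning
    p : Subset a → Carrier
    p u = π (subsequence A u)
    q : Subset (suc a) → Carrier
    q v = π (subsequence (g ∷ A) v)
    row : Carrier → Carrier → Subset a → ℕ
    row x y u = ∑[ v ∈ subsets a ] δ (x ∙ p u) (y ∙ p v)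
    split : ∀ w → ∑ (subsets (suc a)) (λ v → δ w (y ∙ q v)) ≡
                  ∑[ v ∈ subsets a ] (δ w (y ∙ p v) + δ w ((y ∙ g) ∙ p v))
    split w = trans (∑-subsets a _) (∑-cong (subsets a) (λ v →
      cong (δ w (y ∙ p v) +_) (δ-cong ≈-refl (≈-sym (assoc y g (p v))))))

  sequences : ∀ a → List (Vec Carrier a)
  sequences = vectors elements

  totalPairs : ℕ → Carrier → Carrier → ℕ
  totalPairs a x y = ∑[ A ∈ sequences a ] pairs A x y

  totalPairs-suc : ∀ a x y → totalPairs (suc a) x y ≡
    ∑[ g ∈ elements ] ((totalPairs a x y + totalPairs a x (y ∙ g)) +
                       (totalPairs a (x ∙ g) y + totalPairs a (x ∙ g) (y ∙ g)))
  totalPairs-suc a x y = trans (∑-vectors elements a _) (∑-cong elements (λ g →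
    trans (∑-cong (sequences a) (λ A → pairs-∷ g A x y))
          (trans (∑-+ (sequences a) _ _) (cong₂ _+_ (∑-+ (sequences a) _ _) (∑-+ (sequences a) _ _)))))

  -- That is, n totalPairs = nᵃ (4ᵃ - 2ᵃ + n 2ᵃ δ x y).
  totalPairs-≡ : ∀ a x y →
    n * totalPairs a x y + n ^ a * 2 ^ a ≡ n ^ a * (2 ^ a * 2 ^ a + n * 2 ^ a * δ x y)
  totalPairs-≡ zero x y = trans (cong (λ t → n * (t + 0 + 0 + 0) + 1) (δ-cong (identityʳ x) (identityʳ y)))
                                (base n (δ x y))
    where
    base : ∀ n d → n * (d + 0 + 0 + 0) + 1 ≡ 1 * (1 + n * 1 * d)
    base = solve-∀
  totalPairs-≡ (suc a) x y = +-cancelʳ-≡ (2 * n * N * α) _ _ (begin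
    n * totalPairs (suc a) x y + n * N * (2 * α) + 2 * n * N * α
      ≡⟨ cong (λ t → n * t + n * N * (2 * α) + 2 * n * N * α) (totalPairs-suc a x y) ⟩
    n * ∑ elements four + n * N * (2 * α) + 2 * n * N * α
      ≡⟨ regroup₁ n (∑ elements four) N α ⟩
    n * ∑ elements four + n * (4 * (N * α))
      ≡⟨ cong₂ _+_ (sym (∑-*ˡ n elements four))
                   (trans (cong (_* (4 * (N * α))) (sym length-elements)) (sym (∑-const elements _))) ⟩
    ∑[ g ∈ elements ] (n * four g) + ∑[ _ ∈ elements ] (4 * (N * α))
      ≡⟨ ∑-+ elements _ _ ⟨
    ∑[ g ∈ elements ] (n * four g + 4 * (N * α))
      ≡⟨ ∑-cong elements step ⟩
    ∑[ g ∈ elements ] (N * (4 * (α * α) + n * α * (2 * d) + n * α * (δ x (y ∙ g) + δ (x ∙ g) y)))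
      ≡⟨ ∑-*ˡ N elements _ ⟩
    N * (∑[ g ∈ elements ] (4 * (α * α) + n * α * (2 * d) + n * α * (δ x (y ∙ g) + δ (x ∙ g) y)))
      -- For each of the two mixed terms exactly one g gives equality, whatever x and y are. This is
      -- where the uniformity of the new entry enters.
      ≡⟨ cong (N *_) (trans (∑-+ elements _ _) (cong₂ _+_
           (trans (∑-const elements _) (cong (_* (4 * (α * α) + n * α * (2 * d))) length-elements))
           (trans (∑-*ˡ (n * α) elements _) (cong (n * α *_) (trans (∑-+ elements _ _)
             (cong₂ _+_ (∑-δ-∙ x y) (trans (∑-cong elements (λ g → δ-sym _ _)) (∑-δ-∙ y x)))))))) ⟩
    N * (n * (4 * (α * α) + n * α * (2 * d)) + n * α * 2)
      ≡⟨ regroup₂ n N α d ⟩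
    n * N * (2 * α * (2 * α) + n * (2 * α) * d) + 2 * n * N * α ∎)
    where
    open ≡-Reasoning
    N = n ^ a
    α = 2 ^ a
    d = δ x y
    T = totalPairs a
    four : Carrier → ℕ
    four g = (T x y + T x (y ∙ g)) + (T (x ∙ g) y + T (x ∙ g) (y ∙ g))
    regroup₁ : ∀ n s N α → n * s + n * N * (2 * α) + 2 * n * N * α ≡ n * s + n * (4 * (N * α))
    regroup₁ = solve-∀
    regroup₂ : ∀ n N α d → N * (n * (4 * (α * α) + n * α * (2 * d)) + n * α * 2) ≡
                           n * N * (2 * α * (2 * α) + n * (2 * α) * d) + 2 * n * N * α
    regroup₂ = solve-∀
    distribute : ∀ n p q r s k → n * ((p + q) + (r + s)) + 4 * k ≡
                                 ((n * p + k) + (n * q + k)) + ((n * r + k) + (n * s + k))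
    distribute = solve-∀
    collect : ∀ N A k p q r →
      ((N * (A + k * p)) + (N * (A + k * q))) + ((N * (A + k * r)) + (N * (A + k * p))) ≡
      N * (4 * A + k * (2 * p) + k * (q + r))
    collect = solve-∀
    step : ∀ g → n * four g + 4 * (N * α) ≡
                 N * (4 * (α * α) + n * α * (2 * d) + n * α * (δ x (y ∙ g) + δ (x ∙ g) y))
    step g = begin
      n * four g + 4 * (N * α)
        ≡⟨ distribute n (T x y) (T x (y ∙ g)) (T (x ∙ g) y) (T (x ∙ g) (y ∙ g)) (N * α) ⟩
      ((n * T x y + N * α) + (n * T x (y ∙ g) + N * α)) +
      ((n * T (x ∙ g) y + N * α) + (n * T (x ∙ g) (y ∙ g) + N * α))
        ≡⟨ cong₂ _+_ (cong₂ _+_ (totalPairs-≡ a x y) (totalPairs-≡ a x (y ∙ g)))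
             (cong₂ _+_ (totalPairs-≡ a (x ∙ g) y) (trans (totalPairs-≡ a (x ∙ g) (y ∙ g))
               (cong (λ t → N * (α * α + n * α * t)) (δ-⇔ (∙-cancelʳ g x y) ∙-congʳ)))) ⟩
      ((N * (α * α + n * α * d)) + (N * (α * α + n * α * δ x (y ∙ g)))) +
      ((N * (α * α + n * α * δ (x ∙ g) y)) + (N * (α * α + n * α * d)))
        ≡⟨ collect N (α * α) (n * α) d (δ x (y ∙ g)) (δ (x ∙ g) y) ⟩
      N * (4 * (α * α) + n * α * (2 * d) + n * α * (δ x (y ∙ g) + δ (x ∙ g) y)) ∎

  -- The deviation from the mean 2ᵃ / n, multiplied by n to remain an integer; `variance` is
  -- accordingly n² times the sum of the squared deviations.
  deviation : ∀ {a} → Vec Carrier a → Carrier → ℕ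
  deviation {a} A g = ∣ n * representations A g - 2 ^ a ∣

  variance : ∀ {a} → Vec Carrier a → ℕ
  variance A = ∑[ g ∈ elements ] (deviation A g * deviation A g)

  -- For every single A the average over g of the representations is exactly 2ᵃ / n, so that the
  -- variance over g is determined by the collision count.
  variance-≡ : ∀ {a} (A : Vec Carrier a) →
               variance A + n * (2 ^ a * 2 ^ a) ≡ n * n * pairs A ε ε
  variance-≡ {a} A = +-cancelʳ-≡ (n * (α * α)) _ _ (begin
    variance A + n * (α * α) + n * (α * α)
      ≡⟨ regroup (variance A) n α ⟩
    variance A + 2 * n * α * α
      ≡⟨ cong (λ t → variance A + 2 * n * α * t) (∑-representations A) ⟨
    variance A + 2 * n * α * ∑ elements R
      ≡⟨ cong (variance A +_) (∑-*ˡ (2 * n * α) elements R) ⟨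
    variance A + ∑[ g ∈ elements ] (2 * n * α * R g)
      ≡⟨ ∑-+ elements _ _ ⟨
    ∑[ g ∈ elements ] (deviation A g * deviation A g + 2 * n * α * R g)
      ≡⟨ ∑-cong elements (λ g → trans (cong (deviation A g * deviation A g +_) (cross n α (R g)))
           (trans (∣-∣²-identity (n * R g) α) (cong (_+ α * α) (square n (R g))))) ⟩
    ∑[ g ∈ elements ] (n * n * (R g * R g) + α * α)
      ≡⟨ ∑-+ elements _ _ ⟩
    ∑[ g ∈ elements ] (n * n * (R g * R g)) + ∑[ _ ∈ elements ] (α * α)
      ≡⟨ cong₂ _+_ (trans (∑-*ˡ (n * n) elements _) (cong (n * n *_) (∑-representations² A)))
                   (trans (∑-const elements _) (cong (_* (α * α)) length-elements)) ⟩
    n * n * pairs A ε ε + n * (α * α) ∎)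
    where
    open ≡-Reasoning
    α = 2 ^ a
    R = representations A
    regroup : ∀ v n α → v + n * (α * α) + n * (α * α) ≡ v + 2 * n * α * α
    regroup = solve-∀
    cross : ∀ n α r → 2 * n * α * r ≡ 2 * (n * r * α)
    cross = solve-∀
    square : ∀ n r → n * r * (n * r) ≡ n * n * (r * r)
    square = solve-∀

  ∑-variance : ∀ a → ∑ (sequences a) variance ≤ n ^ a * (n * n * 2 ^ a)
  ∑-variance a = +-cancelʳ-≤ (N * (n * (α * α))) _ _ (begin
    ∑ (sequences a) variance + N * (n * (α * α))
      ≡⟨ cong (∑ (sequences a) variance +_) (trans (cong (_* (n * (α * α)))
           (trans (cong (_^ a) (sym length-elements)) (sym (length-vectors elements a))))
           (sym (∑-const (sequences a) _))) ⟩
    ∑ (sequences a) variance + ∑[ _ ∈ sequences a ] (n * (α * α))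
      ≡⟨ ∑-+ (sequences a) _ _ ⟨
    ∑[ A ∈ sequences a ] (variance A + n * (α * α))
      ≡⟨ ∑-cong (sequences a) variance-≡ ⟩
    ∑[ A ∈ sequences a ] (n * n * pairs A ε ε)
      ≡⟨ ∑-*ˡ (n * n) (sequences a) _ ⟩
    n * n * totalPairs a ε ε
      ≡⟨ *-assoc n n _ ⟩
    n * (n * totalPairs a ε ε)
      ≤⟨ *-monoʳ-≤ n (m≤m+n _ (N * α)) ⟩
    n * (n * totalPairs a ε ε + N * α)
      ≡⟨ cong (n *_) (totalPairs-≡ a ε ε) ⟩
    n * (N * (α * α + n * α * δ ε ε))
      ≤⟨ *-monoʳ-≤ n (*-monoʳ-≤ N (+-monoʳ-≤ (α * α) (*-monoʳ-≤ (n * α) (𝟙≤1 _)))) ⟩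
    n * (N * (α * α + n * α * 1))
      ≡⟨ regroup n N α ⟩
    N * (n * n * α) + N * (n * (α * α)) ∎)
    where
    open ≤-Reasoning
    N = n ^ a
    α = 2 ^ a
    regroup : ∀ n N α → n * (N * (α * α + n * α * 1)) ≡ N * (n * n * α) + N * (n * (α * α))
    regroup = solve-∀

  Balanced : ∀ {a} → Vec Carrier a → Carrier → Set
  Balanced {a} A g = 2 ^ a ≤ 2 * (n * representations A g) × 2 * (n * representations A g) ≤ 3 * 2 ^ a

  balanced? : ∀ {a} (A : Vec Carrier a) g → Dec (Balanced A g)
  balanced? {a} A g =
    (2 ^ a ≤? 2 * (n * representations A g)) ×-dec (2 * (n * representations A g) ≤? 3 * 2 ^ a)

  -- Quantifying over indices makes this decidable by a finite search; `regular⇒balanced` carries it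
  -- over to all group elements.
  Regular : ∀ {a} → Vec Carrier a → Set
  Regular A = ∀ i → Balanced A (to i)

  regular? : ∀ {a} (A : Vec Carrier a) → Dec (Regular A)
  regular? A = Fin.all? (λ i → balanced? A (to i))

  regular⇒balanced : ∀ {a} (A : Vec Carrier a) → Regular A → ∀ g → Balanced A g
  regular⇒balanced {a} A reg g =
    subst (λ r → 2 ^ a ≤ 2 * (n * r) × 2 * (n * r) ≤ 3 * 2 ^ a)
      (representations-cong A (strictlyInverseˡ g)) (reg (identifier g))

  irregular : ∀ {a} → Vec Carrier a → ℕ
  irregular A = 𝟙 (not (does (regular? A)))

  unbalanced⇒deviation : ∀ {a} (A : Vec Carrier a) g → ¬ Balanced A g → 2 ^ a ≤ 2 * deviation A g
  unbalanced⇒deviation {a} A g ¬bal with 2 ^ a ≤? 2 * (n * representations A g)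
  ... | no small = +-cancelˡ-≤ α _ _ (begin
      α + α                                   ≡⟨ cong (α +_) (+-identityʳ α) ⟨
      2 * α                                   ≤⟨ *-monoʳ-≤ 2 (m≤n+m∸n α r) ⟩
      2 * (r + (α ∸ r))                       ≡⟨ *-distribˡ-+ 2 r _ ⟩
      2 * r + 2 * (α ∸ r)                     ≤⟨ +-mono-≤ (<⇒≤ (≰⇒> small)) (*-monoʳ-≤ 2 (m∸n≤∣m-n∣ α r)) ⟩
      α + 2 * ∣ α - r ∣                       ≡⟨ cong (λ t → α + 2 * t) (∣-∣-comm α r) ⟩
      α + 2 * deviation A g ∎)
    where
    open ≤-Reasoning
    α = 2 ^ a
    r = n * representations A g
  ... | yes large = +-cancelˡ-≤ (2 * α) _ _ (begin
      2 * α + α                               ≡⟨ +-comm (2 * α) α ⟩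
      3 * α                                   ≤⟨ <⇒≤ (≰⇒> (λ ok → ¬bal (large , ok))) ⟩
      2 * r                                   ≤⟨ *-monoʳ-≤ 2 (m≤n+m∸n r α) ⟩
      2 * (α + (r ∸ α))                       ≡⟨ *-distribˡ-+ 2 α _ ⟩
      2 * α + 2 * (r ∸ α)                     ≤⟨ +-monoʳ-≤ (2 * α) (*-monoʳ-≤ 2 (m∸n≤∣m-n∣ r α)) ⟩
      2 * α + 2 * deviation A g               ∎)
    where
    open ≤-Reasoning
    α = 2 ^ a
    r = n * representations A g

  -- Chebyshev's inequality and the union bound over g at once: a single unbalanced g already
  -- contributes 4ᵃ / 4 to the variance, which is summed over all of G.
  irregular-≤ : ∀ {a} (A : Vec Carrier a) → 2 ^ a * 2 ^ a * irregular A ≤ 4 * variance A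
  irregular-≤ {a} A = *-𝟙-not-≤ (regular? A) (λ ¬reg →
    let i , ¬bal = Fin.¬∀⟶∃¬ n (λ i → Balanced A (to i)) (λ i → balanced? A (to i)) ¬reg
        far      = unbalanced⇒deviation A (to i) ¬bal
        D        = deviation A (to i)
    in begin
      2 ^ a * 2 ^ a             ≤⟨ *-mono-≤ far far ⟩
      2 * D * (2 * D)           ≡⟨ regroup D ⟩
      4 * (D * D)               ≤⟨ *-monoʳ-≤ 4 (∑-tabulate-≥ to (λ g → deviation A g * deviation A g) i) ⟩
      4 * variance A            ∎)
    where
    open ≤-Reasoning
    regroup : ∀ D → 2 * D * (2 * D) ≡ 4 * (D * D)
    regroup = solve-∀

  ∑-irregular : ∀ a → 2 ^ a * ∑ (sequences a) irregular ≤ 4 * (n * n) * n ^ a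
  ∑-irregular a = *-cancelˡ-≤ (2 ^ a) {{m^n≢0 2 a}} (begin
    α * (α * ∑ (sequences a) irregular)           ≡⟨ *-assoc α α _ ⟨
    α * α * ∑ (sequences a) irregular             ≡⟨ ∑-*ˡ (α * α) (sequences a) irregular ⟨
    ∑[ A ∈ sequences a ] (α * α * irregular A)    ≤⟨ ∑-mono (sequences a) irregular-≤ ⟩
    ∑[ A ∈ sequences a ] (4 * variance A)         ≡⟨ ∑-*ˡ 4 (sequences a) variance ⟩
    4 * ∑ (sequences a) variance                  ≤⟨ *-monoʳ-≤ 4 (∑-variance a) ⟩
    4 * (n ^ a * (n * n * α))                     ≡⟨ regroup (n ^ a) (n * n) α ⟩
    α * (4 * (n * n) * n ^ a)                     ∎)
    where
    open ≤-Reasoning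
    α = 2 ^ a
    regroup : ∀ N m α → 4 * (N * (m * α)) ≡ α * (4 * m * N)
    regroup = solve-∀

-- The random walk

module _ {ℓ} {C : Set ℓ} (cs : List C) where

  -- Deferred decisions: a coordinate on which F does not otherwise depend
  -- may be drawn afresh.
  resample : ∀ {n} (g : Fin n) (F : C → Vec C n → ℕ) →
    (∀ c η c′ → F c (η [ g ]≔ c′) ≡ F c η) →
    length cs * ∑[ η ∈ vectors cs n ] F (lookup η g) η ≡ ∑[ c ∈ cs ] ∑[ η ∈ vectors cs n ] F c η
  resample {suc n} zero F indep = begin
    length cs * ∑[ η ∈ vectors cs (suc n) ] F (lookup η zero) η
      ≡⟨ cong (length cs *_) (∑-vectors cs n _) ⟩
    length cs * ∑[ x ∈ cs ] ∑[ η ∈ vectors cs n ] F x (x ∷ η)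
      ≡⟨ ∑-*ˡ (length cs) cs _ ⟨
    ∑[ x ∈ cs ] (length cs * ∑[ η ∈ vectors cs n ] F x (x ∷ η))
      ≡⟨ ∑-cong cs (λ x → sym (∑-const cs _)) ⟩
    ∑[ x ∈ cs ] ∑[ y ∈ cs ] ∑[ η ∈ vectors cs n ] F x (x ∷ η)
      ≡⟨ ∑-cong cs (λ x → ∑-cong cs (λ y → ∑-cong (vectors cs n) (λ η → indep x (y ∷ η) x))) ⟩
    ∑[ x ∈ cs ] ∑[ y ∈ cs ] ∑[ η ∈ vectors cs n ] F x (y ∷ η)
      ≡⟨ ∑-cong cs (λ x → sym (∑-vectors cs n _)) ⟩
    ∑[ x ∈ cs ] ∑[ η ∈ vectors cs (suc n) ] F x η ∎
    where open ≡-Reasoning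
  resample {suc n} (suc g) F indep = begin
    length cs * ∑[ η ∈ vectors cs (suc n) ] F (lookup η (suc g)) η
      ≡⟨ cong (length cs *_) (∑-vectors cs n _) ⟩
    length cs * ∑[ x ∈ cs ] ∑[ η ∈ vectors cs n ] F (lookup η g) (x ∷ η)
      ≡⟨ ∑-*ˡ (length cs) cs _ ⟨
    ∑[ x ∈ cs ] (length cs * ∑[ η ∈ vectors cs n ] F (lookup η g) (x ∷ η))
      ≡⟨ ∑-cong cs (λ x → resample g (λ c η → F c (x ∷ η)) (λ c η → indep c (x ∷ η))) ⟩
    ∑[ x ∈ cs ] ∑[ c ∈ cs ] ∑[ η ∈ vectors cs n ] F c (x ∷ η)
      ≡⟨ ∑-swap cs cs _ ⟩
    ∑[ c ∈ cs ] ∑[ x ∈ cs ] ∑[ η ∈ vectors cs n ] F c (x ∷ η)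
      ≡⟨ ∑-cong cs (λ c → sym (∑-vectors cs n _)) ⟩
    ∑[ c ∈ cs ] ∑[ η ∈ vectors cs (suc n) ] F c η ∎
    where open ≡-Reasoning

𝟙-∨ : ∀ x y → ¬ (x ≡ true × y ≡ true) → 𝟙 (x ∨ y) ≡ 𝟙 x + 𝟙 y
𝟙-∨ true  true  ¬both = contradiction (refl , refl) ¬both
𝟙-∨ true  false _     = refl
𝟙-∨ false y     _     = refl

∧-true : ∀ {x y} → x ∧ y ≡ true → x ≡ true × y ≡ true
∧-true {true} p = refl , p

module Walk {C : Set} {n} (label : C → Fin n) (opposite : C → C → Bool) where

  match : C → C → Bool
  match v c = does (label v Fin.≟ label c)

  hit : List C → Fin n → Bool
  hit V g = any (λ v → does (label v Fin.≟ g)) V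

  good : List C → C → Bool
  good V c = any (λ v → match v c ∧ opposite v c) V

  -- The walk c , η (label c) , … , halted by its first repeated label; V
  -- is the list of the elements already visited, in reverse order.
  walk : (List C → C → ℕ) → ℕ → ℕ → List C → C → Vec C n → ℕ
  walk end cost zero    V c η = end V c
  walk end cost (suc k) V c η =
    if hit V (label c) then end V c else cost + walk end cost k (c ∷ V) (lookup η (label c)) η

  duration : ℕ → List C → C → Vec C n → ℕ
  duration = walk (λ _ _ → 0) 1

  success : ℕ → List C → C → Vec C n → ℕ
  success = walk (λ V c → 𝟙 (good V c)) 0

  -- Such a walk never consults η at g: it halts on reaching a label of V, and V only grows. This is
  -- the independence that `resample` asks for.
  walk-update : ∀ end cost k V c η g c′ → hit V g ≡ true →
                walk end cost k V c (η [ g ]≔ c′) ≡ walk end cost k V c η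
  walk-update end cost zero    V c η g c′ g∈V = refl
  walk-update end cost (suc k) V c η g c′ g∈V with hit V (label c) in eq
  ... | true  = refl
  ... | false = cong (cost +_) (begin
    walk end cost k (c ∷ V) (lookup (η [ g ]≔ c′) (label c)) (η [ g ]≔ c′)
      ≡⟨ walk-update end cost k (c ∷ V) _ η g c′ g∈c∷V ⟩
    walk end cost k (c ∷ V) (lookup (η [ g ]≔ c′) (label c)) η
      ≡⟨ cong (λ x → walk end cost k (c ∷ V) x η) (lookup∘update′ new η c′) ⟩
    walk end cost k (c ∷ V) (lookup η (label c)) η ∎)
    where
    open ≡-Reasoning
    new : label c ≢ g
    new refl with () ← trans (sym eq) g∈V
    g∈c∷V : hit (c ∷ V) g ≡ true
    g∈c∷V with does (label c Fin.≟ g)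
    ... | true  = refl
    ... | false = g∈V

  -- With distinct labels, the events that c repeats the label of v are disjoint for the various v
  -- in V, so that their counts add up.
  Distinct : List C → Set
  Distinct []      = ⊤
  Distinct (v ∷ V) = hit V (label v) ≡ false × Distinct V

  good⇒hit : ∀ V c → good V c ≡ true → hit V (label c) ≡ true
  good⇒hit (v ∷ V) c p with match v c
  ... | true  = refl
  ... | false = good⇒hit V c p

  ¬hit⇒¬good : ∀ V c → hit V (label c) ≡ false → 𝟙 (good V c) ≡ 0
  ¬hit⇒¬good V c ¬h with good V c in eq
  ... | false = refl
  ... | true with () ← trans (sym ¬h) (good⇒hit V c eq)

  module _ v V (v∉V : hit V (label v) ≡ false) (c : C) where

    match-disjoint : ¬ (match v c ≡ true × hit V (label c) ≡ true)
    match-disjoint (m , h) with label v Fin.≟ label c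
    match-disjoint (m , h) | yes p with () ← trans (sym v∉V) (trans (cong (hit V) p) h)

    hit-∷ : 𝟙 (hit (v ∷ V) (label c)) ≡ 𝟙 (match v c) + 𝟙 (hit V (label c))
    hit-∷ = 𝟙-∨ (match v c) (hit V (label c)) match-disjoint

    good-∷ : 𝟙 (good (v ∷ V) c) ≡ 𝟙 (match v c ∧ opposite v c) + 𝟙 (good V c)
    good-∷ = 𝟙-∨ (match v c ∧ opposite v c) (good V c)
      (λ (m , g) → match-disjoint (proj₁ (∧-true m) , good⇒hit V c g))

  module Average (cs : List C) .{{cs≢[] : NonZero (length cs)}} where

    oracles : List (Vec C n)
    oracles = vectors cs n

    draws# : ℕ
    draws# = length cs * length oracles

    total : (List C → C → ℕ) → ℕ → ℕ → List C → ℕ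
    total end cost k V = ∑[ c ∈ cs ] ∑[ η ∈ oracles ] walk end cost k V c η

    total-hit : ∀ end cost k V c → hit V (label c) ≡ true →
      length cs * ∑[ η ∈ oracles ] walk end cost (suc k) V c η ≡ draws# * end V c
    total-hit end cost k V c h rewrite h =
      trans (cong (length cs *_) (∑-const oracles _)) (sym (*-assoc (length cs) _ _))

    -- No visited element has the label of c, so η is still undetermined there, and `resample` makes
    -- the next element uniform and independent of the rest of η.
    total-miss : ∀ end cost k V c → hit V (label c) ≡ false →
      length cs * ∑[ η ∈ oracles ] walk end cost (suc k) V c η ≡ draws# * cost + total end cost k (c ∷ V)
    total-miss end cost k V c h rewrite h = begin
      length cs * ∑[ η ∈ oracles ] (cost + walk end cost k (c ∷ V) (lookup η (label c)) η)
        ≡⟨ cong (length cs *_) (∑-+ oracles _ _) ⟩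
      length cs * (∑[ _ ∈ oracles ] cost + ∑[ η ∈ oracles ] walk end cost k (c ∷ V) (lookup η (label c)) η)
        ≡⟨ *-distribˡ-+ (length cs) (∑[ _ ∈ oracles ] cost) _ ⟩
      length cs * ∑[ _ ∈ oracles ] cost +
      length cs * ∑[ η ∈ oracles ] walk end cost k (c ∷ V) (lookup η (label c)) η
        ≡⟨ cong₂ _+_ (trans (cong (length cs *_) (∑-const oracles cost)) (sym (*-assoc (length cs) _ _)))
             (resample cs (label c) (walk end cost k (c ∷ V)) (λ x η x′ →
               walk-update end cost k (c ∷ V) x η (label c) x′
                 (cong (_∨ hit V (label c)) (dec-true (label c Fin.≟ label c) refl)))) ⟩
      draws# * cost + total end cost k (c ∷ V) ∎
      where open ≡-Reasoning

    hits goods : List C → ℕ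
    hits V  = ∑[ c ∈ cs ] 𝟙 (hit V (label c))
    goods V = ∑[ c ∈ cs ] 𝟙 (good V c)

    module Bounds .{{n≢0 : NonZero n}}
      (frequent : ∀ v → length cs ≤ 2 * n * ∑[ c ∈ cs ] 𝟙 (match v c))
      (useful   : ∀ v → ∑[ c ∈ cs ] 𝟙 (match v c) ≤ 7 * ∑[ c ∈ cs ] 𝟙 (match v c ∧ opposite v c))
      where

      hits-≥ : ∀ V → Distinct V → length V * length cs ≤ 2 * n * hits V
      hits-≥ []      _         = z≤n
      hits-≥ (v ∷ V) (v∉V , D) = begin
        length cs + length V * length cs
          ≤⟨ +-mono-≤ (frequent v) (hits-≥ V D) ⟩
        2 * n * ∑[ c ∈ cs ] 𝟙 (match v c) + 2 * n * hits V
          ≡⟨ *-distribˡ-+ (2 * n) (∑[ c ∈ cs ] 𝟙 (match v c)) (hits V) ⟨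
        2 * n * (∑[ c ∈ cs ] 𝟙 (match v c) + hits V)
          ≡⟨ cong (2 * n *_) (trans (sym (∑-+ cs _ _)) (∑-cong cs (λ c → sym (hit-∷ v V v∉V c)))) ⟩
        2 * n * hits (v ∷ V) ∎
        where open ≤-Reasoning

      hits-≤ : ∀ V → Distinct V → hits V ≤ 7 * goods V
      hits-≤ []      _         =
        ≤-trans (≤-reflexive (trans (∑-const cs 0) (*-zeroʳ (length cs)))) z≤n
      hits-≤ (v ∷ V) (v∉V , D) = begin
        hits (v ∷ V)
          ≡⟨ trans (∑-cong cs (hit-∷ v V v∉V)) (∑-+ cs _ _) ⟩
        ∑[ c ∈ cs ] 𝟙 (match v c) + hits V
          ≤⟨ +-mono-≤ (useful v) (hits-≤ V D) ⟩
        7 * ∑[ c ∈ cs ] 𝟙 (match v c ∧ opposite v c) + 7 * goods V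
          ≡⟨ *-distribˡ-+ 7 (∑[ c ∈ cs ] 𝟙 (match v c ∧ opposite v c)) (goods V) ⟨
        7 * (∑[ c ∈ cs ] 𝟙 (match v c ∧ opposite v c) + goods V)
          ≡⟨ cong (7 *_) (trans (sym (∑-+ cs _ _)) (∑-cong cs (λ c → sym (good-∷ v V v∉V c)))) ⟩
        7 * goods (v ∷ V) ∎
        where open ≤-Reasoning

      -- A walk that stops now is good with conditional probability at least 1 / 7, and one that
      -- goes on is covered by induction. When the fuel is spent, V has n entries, and `hits-≥`
      -- certifies a repetition with probability 1 / 2 only; hence 14 rather than 7.
      success-≥ : ∀ k V → Distinct V → k + length V ≡ n →
        draws# ≤ 14 * total (λ V c → 𝟙 (good V c)) 0 k V
      success-≥ zero V D refl = begin
        length cs * length oracles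
          ≤⟨ *-monoˡ-≤ (length oracles) (*-cancelˡ-≤ n (begin
               n * length cs        ≤⟨ hits-≥ V D ⟩
               2 * n * hits V       ≡⟨ trans (cong (_* hits V) (*-comm 2 n)) (*-assoc n 2 (hits V)) ⟩
               n * (2 * hits V)     ≤⟨ *-monoʳ-≤ n (*-monoʳ-≤ 2 (hits-≤ V D)) ⟩
               n * (2 * (7 * goods V)) ∎)) ⟩
        2 * (7 * goods V) * length oracles
          ≡⟨ regroup (goods V) (length oracles) ⟩
        14 * (goods V * length oracles)
          ≡⟨ cong (14 *_) (trans (sym (∑-*ʳ (length oracles) cs _))
               (∑-cong cs (λ c → trans (*-comm (𝟙 (good V c)) _) (sym (∑-const oracles _))))) ⟩
        14 * total (λ V c → 𝟙 (good V c)) 0 zero V ∎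
        where
        open ≤-Reasoning
        regroup : ∀ x y → 2 * (7 * x) * y ≡ 14 * (x * y)
        regroup = solve-∀
      -- Adding the weight of the hits on both sides allows a comparison for each c separately: on a
      -- hit the two sides agree, and on a miss the induction hypothesis supplies `draws#`.
      success-≥ (suc k) V D refl = *-cancelˡ-≤ (length cs) (+-cancelʳ-≤ (draws# * hits V) _ _ (begin
        length cs * draws# + draws# * hits V
          ≤⟨ +-monoʳ-≤ _ (*-monoʳ-≤ draws# (≤-trans (hits-≤ V D) (*-monoˡ-≤ (goods V) (m≤m+n 7 7)))) ⟩
        length cs * draws# + draws# * (14 * goods V)
          ≡⟨ cong₂ _+_ (∑-const cs draws#)
               (trans (∑-*ˡ draws# cs _) (cong (draws# *_) (∑-*ˡ 14 cs _))) ⟨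
        ∑[ _ ∈ cs ] draws# + ∑[ c ∈ cs ] (draws# * (14 * 𝟙 (good V c)))
          ≡⟨ ∑-+ cs _ _ ⟨
        ∑[ c ∈ cs ] (draws# + draws# * (14 * 𝟙 (good V c)))
          ≤⟨ ∑-mono cs pointwise ⟩
        ∑[ c ∈ cs ] (14 * (length cs * next c) + draws# * 𝟙 (hit V (label c)))
          ≡⟨ ∑-+ cs _ _ ⟩
        ∑[ c ∈ cs ] (14 * (length cs * next c)) + ∑[ c ∈ cs ] (draws# * 𝟙 (hit V (label c)))
          ≡⟨ cong₂ _+_ (trans (∑-*ˡ 14 cs _) (cong (14 *_) (∑-*ˡ (length cs) cs _))) (∑-*ˡ draws# cs _) ⟩
        14 * (length cs * total end 0 (suc k) V) + draws# * hits V
          ≡⟨ cong (_+ draws# * hits V) (regroup (length cs) (total end 0 (suc k) V)) ⟩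
        length cs * (14 * total end 0 (suc k) V) + draws# * hits V ∎))
        where
        open ≤-Reasoning
        end : List C → C → ℕ
        end V c = 𝟙 (good V c)
        next : C → ℕ
        next c = ∑[ η ∈ oracles ] walk end 0 (suc k) V c η
        regroup : ∀ x y → 14 * (x * y) ≡ x * (14 * y)
        regroup = solve-∀
        rearrange : ∀ K x → K + K * (14 * x) ≡ 14 * (K * x) + K * 1
        rearrange = solve-∀
        pointwise : ∀ c → draws# + draws# * (14 * 𝟙 (good V c)) ≤
                          14 * (length cs * next c) + draws# * 𝟙 (hit V (label c))
        pointwise c = cases (hit V (label c)) refl
          where
          cases : ∀ h → hit V (label c) ≡ h → draws# + draws# * (14 * 𝟙 (good V c)) ≤
                                              14 * (length cs * next c) + draws# * 𝟙 h
          cases true  h = ≤-reflexive (trans (rearrange draws# (𝟙 (good V c)))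
            (cong (λ t → 14 * t + draws# * 1) (sym (total-hit end 0 k V c h))))
          cases false h = begin
            draws# + draws# * (14 * 𝟙 (good V c))
              ≡⟨ cong (λ t → draws# + draws# * (14 * t)) (¬hit⇒¬good V c h) ⟩
            draws# + draws# * 0
              ≤⟨ +-monoˡ-≤ (draws# * 0) (success-≥ k (c ∷ V) (h , D) (+-suc k (length V))) ⟩
            14 * total end 0 k (c ∷ V) + draws# * 0
              ≡⟨ cong (λ t → 14 * (t + total end 0 k (c ∷ V)) + draws# * 0) (*-zeroʳ draws#) ⟨
            14 * (draws# * 0 + total end 0 k (c ∷ V)) + draws# * 0
              ≡⟨ cong (λ t → 14 * t + draws# * 0) (total-miss end 0 k V c h) ⟨
            14 * (length cs * next c) + draws# * 0 ∎

      -- With at least s elements visited, a repetition occurs at each step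
      -- with probability at least 1 / 2 s.
      potential : ℕ → ℕ → ℕ
      potential s t = 2 * s + (s ∸ t)

      -- In terms of the probability p of a repetition and t = `length V`, this says (1 - p) (1 + R
      -- (t + 1)) ≤ R t for the potential R. Before time s the potential falls by one per step; from
      -- then on it is 2 s, while p ≥ t / 2 n ≥ 1 / 2 s.
      potential-≤ : ∀ s .{{_ : NonZero s}} → n ≤ s * s → ∀ V → Distinct V →
        suc (potential s (suc (length V))) * length cs ≤
        potential s (length V) * length cs + suc (potential s (suc (length V))) * hits V
      potential-≤ s n≤s² V D with s ≤? length V
      ... | no s≰V = begin
        suc (potential s (suc t)) * length cs
          ≡⟨ cong (_* length cs) (trans (sym (+-suc (2 * s) (s ∸ suc t)))
               (cong (2 * s +_) (sym (∸-suc (≰⇒> s≰V))))) ⟩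
        potential s t * length cs
          ≤⟨ m≤m+n _ _ ⟩
        potential s t * length cs + suc (potential s (suc t)) * hits V ∎
        where
        open ≤-Reasoning
        t = length V
        ∸-suc : ∀ {m n} → suc m ≤ n → n ∸ m ≡ suc (n ∸ suc m)
        ∸-suc {zero}  (s≤s _) = refl
        ∸-suc {suc m} (s≤s p) = ∸-suc p
      ... | yes s≤V = begin
        suc (potential s (suc t)) * length cs
          ≡⟨ cong (λ x → suc (2 * s + x) * length cs) (m≤n⇒m∸n≡0 (m≤n⇒m≤1+n s≤V)) ⟩
        length cs + (2 * s + 0) * length cs
          ≡⟨ +-comm (length cs) _ ⟩
        (2 * s + 0) * length cs + length cs
          ≤⟨ +-mono-≤ (*-monoˡ-≤ (length cs) (+-monoʳ-≤ (2 * s) z≤n)) (*-cancelˡ-≤ s (begin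
               s * length cs          ≤⟨ *-monoˡ-≤ (length cs) s≤V ⟩
               t * length cs          ≤⟨ hits-≥ V D ⟩
               2 * n * hits V         ≤⟨ *-monoˡ-≤ (hits V) (*-monoʳ-≤ 2 n≤s²) ⟩
               2 * (s * s) * hits V   ≡⟨ regroup s (hits V) ⟩
               s * (2 * s * hits V)   ∎)) ⟩
        potential s t * length cs + 2 * s * hits V
          ≤⟨ +-monoʳ-≤ _ (*-monoˡ-≤ (hits V) (m≤n⇒m≤1+n (m≤m+n (2 * s) (s ∸ suc t)))) ⟩
        potential s t * length cs + suc (potential s (suc t)) * hits V ∎
        where
        open ≤-Reasoning
        t = length V
        regroup : ∀ s h → 2 * (s * s) * h ≡ s * (2 * s * h)
        regroup = solve-∀

      -- By `potential-≤`, the potential pays for the current step and for the expected rest of the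
      -- walk. At the start it equals 3 s.
      duration-≤ : ∀ s .{{_ : NonZero s}} → n ≤ s * s → ∀ k V → Distinct V →
        total (λ _ _ → 0) 1 k V ≤ potential s (length V) * draws#
      duration-≤ s n≤s² zero V D =
        ≤-trans (≤-reflexive (trans (∑-cong cs (λ _ → trans (∑-const oracles 0) (*-zeroʳ (length oracles))))
          (trans (∑-const cs 0) (*-zeroʳ (length cs))))) z≤n
      duration-≤ s n≤s² (suc k) V D =
        *-cancelˡ-≤ (length cs) (+-cancelʳ-≤ (draws# * (R′ * hits V)) _ _ (begin
        length cs * total end 1 (suc k) V + draws# * (R′ * hits V)
          ≡⟨ cong₂ _+_ (∑-*ˡ (length cs) cs _)
               (trans (∑-*ˡ draws# cs _) (cong (draws# *_) (∑-*ˡ R′ cs _))) ⟨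
        ∑[ c ∈ cs ] (length cs * next c) + ∑[ c ∈ cs ] (draws# * (R′ * 𝟙 (hit V (label c))))
          ≡⟨ ∑-+ cs _ _ ⟨
        ∑[ c ∈ cs ] (length cs * next c + draws# * (R′ * 𝟙 (hit V (label c))))
          ≤⟨ ∑-mono cs (λ c → pointwise c (hit V (label c)) refl) ⟩
        ∑[ _ ∈ cs ] (draws# * R′)
          ≡⟨ ∑-const cs _ ⟩
        length cs * (draws# * R′)
          ≡⟨ regroup₁ (length cs) draws# R′ ⟩
        draws# * (R′ * length cs)
          ≤⟨ *-monoʳ-≤ draws# (potential-≤ s n≤s² V D) ⟩
        draws# * (R * length cs + R′ * hits V)
          ≡⟨ regroup₂ (length cs) draws# R (R′ * hits V) ⟩
        length cs * (R * draws#) + draws# * (R′ * hits V) ∎))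
        where
        open ≤-Reasoning
        R R′ : ℕ
        R  = potential s (length V)
        R′ = suc (potential s (suc (length V)))
        end : List C → C → ℕ
        end V c = 0
        next : C → ℕ
        next c = ∑[ η ∈ oracles ] walk end 1 (suc k) V c η
        regroup₁ : ∀ l K r → l * (K * r) ≡ K * (r * l)
        regroup₁ = solve-∀
        regroup₂ : ∀ l K r h → K * (r * l + h) ≡ l * (r * K) + K * h
        regroup₂ = solve-∀
        pointwise : ∀ c h → hit V (label c) ≡ h →
                    length cs * next c + draws# * (R′ * 𝟙 h) ≤ draws# * R′
        pointwise c true  h = ≤-reflexive (trans
          (cong (_+ draws# * (R′ * 1)) (trans (total-hit end 1 k V c h) (*-zeroʳ draws#)))
          (cong (draws# *_) (*-identityʳ R′)))
        pointwise c false h = begin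
          length cs * next c + draws# * (R′ * 0)
            ≡⟨ cong₂ _+_ (total-miss end 1 k V c h)
                 (trans (cong (draws# *_) (*-zeroʳ R′)) (*-zeroʳ draws#)) ⟩
          draws# * 1 + total end 1 k (c ∷ V) + 0
            ≡⟨ +-identityʳ _ ⟩
          draws# * 1 + total end 1 k (c ∷ V)
            ≤⟨ +-monoʳ-≤ (draws# * 1) (duration-≤ s n≤s² k (c ∷ V) (h , D)) ⟩
          draws# * 1 + potential s (suc (length V)) * draws#
            ≡⟨ cong₂ _+_ (*-identityʳ draws#) refl ⟩
          R′ * draws#
            ≡⟨ *-comm R′ draws# ⟩
          draws# * R′ ∎

-- Rho-shaped orbits

orbit : ∀ {ℓ} {C : Set ℓ} → (C → C) → C → ℕ → C
orbit f w zero    = w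
orbit f w (suc i) = f (orbit f w i)

-- The orbit of w under f has a tail of length μ and then a cycle of length p.
record Rho {ℓ} {C : Set ℓ} (f : C → C) (w : C) (μ p : ℕ) : Set ℓ where
  field
    .{{p≢0}} : NonZero p
    closed   : orbit f w (p + μ) ≡ orbit f w μ
    distinct : ∀ {i j} → i < j → j < p + μ → orbit f w i ≢ orbit f w j

  private
    x : ℕ → C
    x = orbit f w

  periodic : ∀ i → x (i + (p + μ)) ≡ x (i + μ)
  periodic zero    = closed
  periodic (suc i) = cong f (periodic i)

  periodic* : ∀ q i → x (i + (q * p + μ)) ≡ x (i + μ)
  periodic* zero    i = refl
  periodic* (suc q) i = begin
    x (i + ((p + q * p) + μ))  ≡⟨ cong x (regroup i p (q * p) μ) ⟩
    x ((i + q * p) + (p + μ))  ≡⟨ periodic (i + q * p) ⟩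
    x ((i + q * p) + μ)        ≡⟨ cong x (+-assoc i (q * p) μ) ⟩
    x (i + (q * p + μ))        ≡⟨ periodic* q i ⟩
    x (i + μ)                  ∎
    where
    open ≡-Reasoning
    regroup : ∀ i p s μ → i + ((p + s) + μ) ≡ (i + s) + (p + μ)
    regroup = solve-∀

  locate : ∀ k → k < μ ⊎ ∃₂ λ r q → r < p × k ≡ r + (q * p + μ)
  locate k with μ ≤? k
  ... | no μ≰k  = inj₁ (≰⇒> μ≰k)
  ... | yes μ≤k = inj₂ ((k ∸ μ) % p , (k ∸ μ) ℕ./ p , m%n<n (k ∸ μ) p , (begin
    k                                          ≡⟨ m∸n+n≡m μ≤k ⟨
    (k ∸ μ) + μ                                ≡⟨ cong (_+ μ) (m≡m%n+[m/n]*n (k ∸ μ) p) ⟩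
    (k ∸ μ) % p + (k ∸ μ) ℕ./ p * p + μ          ≡⟨ +-assoc ((k ∸ μ) % p) _ μ ⟩
    (k ∸ μ) % p + ((k ∸ μ) ℕ./ p * p + μ)        ∎))
    where open ≡-Reasoning

  x-injective : ∀ {i j} → i < p + μ → j < p + μ → x i ≡ x j → i ≡ j
  x-injective {i} {j} i< j< eq with <-cmp i j
  ... | tri< i<j _ _ = contradiction eq (distinct i<j j<)
  ... | tri≈ _ i≡j _ = i≡j
  ... | tri> _ _ j<i = contradiction (sym eq) (distinct j<i i<)

  -- Both indices are reduced to the p + μ distinct points of the orbit. Thus any equality the
  -- machine observes shows that the tail is over and that the gap is a multiple of p.
  repetition : ∀ {i j} → i < j → x i ≡ x j → μ ≤ i × ∃[ q ] j ≡ suc q * p + i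
  repetition {i} {j} i<j eq with locate i | locate j
  ... | inj₁ i<μ | inj₁ j<μ =
    contradiction eq (distinct i<j (m≤n⇒m≤o+n p j<μ))
  ... | inj₁ i<μ | inj₂ (r , q , r<p , refl) =
    contradiction (trans eq (periodic* q r)) (distinct (m≤n⇒m≤o+n r i<μ) (+-monoˡ-< μ r<p))
  ... | inj₂ (r , q , r<p , refl) | inj₁ j<μ =
    contradiction (<-trans i<j j<μ) (≤⇒≯ (m≤n⇒m≤o+n r (m≤n+m μ (q * p))))
  ... | inj₂ (r , q , r<p , refl) | inj₂ (r′ , q′ , r′<p , refl) =
    m≤n⇒m≤o+n r (m≤n+m μ (q * p)) , q′ ∸ suc q , (begin
      r′ + (q′ * p + μ)
        ≡⟨ cong₂ (λ r q → r + (q * p + μ)) (sym r≡r′) (sym (m+[n∸m]≡n q<q′)) ⟩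
      r + ((suc q + (q′ ∸ suc q)) * p + μ)     ≡⟨ regroup r q (q′ ∸ suc q) p μ ⟩
      suc (q′ ∸ suc q) * p + (r + (q * p + μ)) ∎)
    where
    open ≡-Reasoning
    r≡r′ : r ≡ r′
    r≡r′ = +-cancelʳ-≡ μ r r′ (x-injective (+-monoˡ-< μ r<p) (+-monoˡ-< μ r′<p)
             (trans (sym (periodic* q r)) (trans eq (periodic* q′ r′))))
    q<q′ : q < q′
    q<q′ = *-cancelʳ-< p q q′ (+-cancelʳ-< μ _ _ (+-cancelˡ-< r′ _ _
             (subst (λ r → r + (q * p + μ) < r′ + (q′ * p + μ)) r≡r′ i<j)))
    regroup : ∀ r q d p μ → r + ((suc q + d) * p + μ) ≡ suc d * p + (r + (q * p + μ))
    regroup = solve-∀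

  -- N is a positive multiple of p that is at least μ: going on for N more steps from x N runs round
  -- the cycle a whole number of times.
  meeting : ∃[ N ] 0 < N × N ≤ p + μ × x N ≡ x (N + N)
  meeting = N , ≤-trans (>-nonZero⁻¹ p) (m≤m+n p _) , N≤ , (begin
    x N                      ≡⟨ cong x (m∸n+n≡m μ≤N) ⟨
    x ((N ∸ μ) + μ)          ≡⟨ periodic* (suc q) (N ∸ μ) ⟨
    x ((N ∸ μ) + (N + μ))    ≡⟨ cong x (trans (cong ((N ∸ μ) +_) (+-comm N μ)) (sym (+-assoc (N ∸ μ) μ N))) ⟩
    x ((N ∸ μ) + μ + N)      ≡⟨ cong (λ t → x (t + N)) (m∸n+n≡m μ≤N) ⟩
    x (N + N)                ∎)
    where
    open ≡-Reasoning
    q N : ℕ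
    q = μ ℕ./ p
    N = suc q * p
    μ-split : μ ≡ μ % p + q * p
    μ-split = m≡m%n+[m/n]*n μ p
    μ≤N : μ ≤ N
    μ≤N = ≤-trans (≤-reflexive μ-split) (+-monoˡ-≤ (q * p) (<⇒≤ (m%n<n μ p)))
    N≤ : N ≤ p + μ
    N≤ = +-monoʳ-≤ p (≤-trans (m≤n+m (q * p) (μ % p)) (≤-reflexive (sym μ-split)))

-- One round of the machine

module Machine {c ℓ n} (G : FiniteGroup c ℓ n) {a b : ℕ}
               (A : Vec (FiniteGroup.Carrier G) a) (B : Vec (FiniteGroup.Carrier G) b)
               (z : FiniteGroup.Carrier G) where
  open SecondMoment G public
  open Pollard G A B z public
  open GroupProperties group
    using (⁻¹-anti-homo-∙; ε⁻¹≈ε; //-rightDividesˡ)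

  value : C → Carrier
  value (inj₁ x) = π (subsequence A x)
  value (inj₂ y) = z ∙ π (subsequence B y) ⁻¹

  label : C → Fin n
  label v = identifier (value v)

  opposite : C → C → Bool
  opposite (inj₁ _) (inj₂ _) = true
  opposite (inj₂ _) (inj₁ _) = true
  opposite _        _        = false

  Solution : Subset (a + b) → Set ℓ
  Solution u = ∃₂ λ x y → u ≡ x Vec.++ y × π (subsequence A x) ∙ π (subsequence B y) ≈ z

  -- A frame holds at most two elements of 𝒞, two counters and one group element. Counters are
  -- bounded by `suc n`: among x 0, ..., x n two labels agree, so the orbit closes at index n + 1 at
  -- the latest.
  counterBound frameBound storageBound : ℕ
  counterBound = ∣ suc n ∣ⁿ
  frameBound   = suc (a + b) + suc (a + b) + (counterBound + counterBound) + ∣element∣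
  storageBound = frameBound + suc (a + b) + (a + b) + (∣element∣ + ∣element∣)

  -- Run η o k C: from C, a round with hash function η ends within k steps,
  -- storing at most storageBound bits; it may end in restart only if o = 0.
  data Run (η : Oracle n a b) (o : ℕ) : ℕ → Config → Set (c Level.⊔ ℓ) where
    halted      : ∀ {k} → o ≡ 0 → Run η o k restart
    solved      : ∀ {k u} → Solution u → Run η o k (output u)
    evaluating  : ∀ {k κ v p g} (let C = evaluate κ v p g) → storage C ≤ storageBound →
                  Run η o k (proj₂ (step η C)) → Run η o (suc k) C
    multiplying : ∀ {k κ v p g h} (let C = multiply κ v p g h) → storage C ≤ storageBound →
                  Run η o k (proj₂ (step η C)) → Run η o (suc k) C

  weaken : ∀ {η o k k′ C} → k ≤ k′ → Run η o k C → Run η o k′ C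
  weaken k≤k′       (halted o≡0)         = halted o≡0
  weaken k≤k′       (solved s)           = solved s
  weaken (s≤s k≤k′) (evaluating st run)  = evaluating st (weaken k≤k′ run)
  weaken (s≤s k≤k′) (multiplying st run) = multiplying st (weaken k≤k′ run)

  resteps : ∀ {η o k k′ C} → k ≡ k′ → Run η o k C → Run η o k′ C
  resteps refl run = run

  ∣v∣≤ : ∀ v → ∣ v ∣ᶜ ≤ suc (a + b)
  ∣v∣≤ (inj₁ _) = s≤s (m≤m+n a b)
  ∣v∣≤ (inj₂ _) = s≤s (m≤n+m b a)

  counter≤ : ∀ {i} → i ≤ suc n → ∣ i ∣ⁿ ≤ counterBound
  counter≤ i≤n = ⌈log₂⌉-mono-≤ (s≤s i≤n)

  -- Crude but sufficient: a position is at most a + b, and that many bits are already O(log n).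
  ∣p∣≤p : ∀ p → ∣ p ∣ⁿ ≤ p
  ∣p∣≤p p = ≤-trans (⌈log₂⌉-mono-≤ (1+p≤2^p p)) (≤-reflexive (⌈log₂2^n⌉≡n p))
    where
    1+p≤2^p : ∀ p → suc p ≤ 2 ^ p
    1+p≤2^p zero    = ≤-refl
    1+p≤2^p (suc p) = +-mono-≤ (m^n>0 2 p) (≤-trans (1+p≤2^p p) (m≤m+n _ 0))

  multiply-storage : ∀ κ v {p} → frameStorage κ ≤ frameBound → p ≤ a + b →
                     frameStorage κ + ∣ v ∣ᶜ + ∣ p ∣ⁿ + ∣element∣ + ∣element∣ ≤ storageBound
  multiply-storage κ v {p} κ≤ p≤ =
    ≤-trans (≤-reflexive (+-assoc (frameStorage κ + ∣ v ∣ᶜ + ∣ p ∣ⁿ) _ _))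
      (+-mono-≤ (+-mono-≤ (+-mono-≤ κ≤ (∣v∣≤ v)) (≤-trans (∣p∣≤p p) p≤)) ≤-refl)

  evaluate-storage : ∀ κ v {p} → frameStorage κ ≤ frameBound → p ≤ a + b →
                     frameStorage κ + ∣ v ∣ᶜ + ∣ p ∣ⁿ + ∣element∣ ≤ storageBound
  evaluate-storage κ v κ≤ p≤ = ≤-trans (m≤m+n _ ∣element∣) (multiply-storage κ v κ≤ p≤)

  -- The factor still missing after p positions, used to state the loop invariant of an evaluation.
  π-from : ∀ {m} → ℕ → Vec Carrier m → Subset m → Carrier
  π-from zero    S       u       = π (subsequence S u)
  π-from (suc p) []      []      = ε
  π-from (suc p) (_ ∷ S) (_ ∷ u) = π-from p S u

  π-from-end : ∀ {m} (S : Vec Carrier m) u → π-from m S u ≈ ε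
  π-from-end []      []      = ≈-refl
  π-from-end (_ ∷ S) (_ ∷ u) = π-from-end S u

  π-from-inside : ∀ {m} p (S : Vec Carrier m) u .(p<m : p < m) → lookup u (fromℕ< p<m) ≡ inside →
                  π-from p S u ≡ lookup S (fromℕ< p<m) ∙ π-from (suc p) S u
  π-from-inside zero    (g ∷ S) (inside ∷ u) p<m eq = refl
  π-from-inside (suc p) (g ∷ S) (_ ∷ u)      p<m eq = π-from-inside p S u (s<s⁻¹ p<m) eq

  π-from-outside : ∀ {m} p (S : Vec Carrier m) u .(p<m : p < m) → lookup u (fromℕ< p<m) ≡ outside →
                   π-from p S u ≡ π-from (suc p) S u
  π-from-outside zero    (g ∷ S) (outside ∷ u) p<m eq = refl
  π-from-outside (suc p) (g ∷ S) (_ ∷ u)       p<m eq = π-from-outside p S u (s<s⁻¹ p<m) eq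

  module Evaluation (η : Oracle n a b) {o k : ℕ} (κ : Frame) (κ≤ : frameStorage κ ≤ frameBound) where

    evaluate-A : ∀ r p x g → r + p ≡ a →
      (∀ h → h ≈ g ∙ π-from p A x → Run η o k (resume η κ (inj₁ x) h)) →
      Run η o (suc r + k) (evaluate κ (inj₁ x) p g)
    evaluate-A zero p x g refl K =
      evaluating (evaluate-storage κ (inj₁ x) κ≤ (m≤m+n a b)) done
      where
      done : Run η o k (proj₂ (step η (evaluate κ (inj₁ x) p g)))
      done with p <? a
      ... | yes p<a = contradiction p<a (<-irrefl refl)
      ... | no _    = K g (≈-sym (≈-trans (∙-congˡ (π-from-end A x)) (identityʳ g)))
    evaluate-A (suc r) p x g refl K =
      evaluating (evaluate-storage κ (inj₁ x) κ≤ (≤-trans (m≤n+m p (suc r)) (m≤m+n a b))) next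
      where
      next : Run η o (suc r + k) (proj₂ (step η (evaluate κ (inj₁ x) p g)))
      next with p <? a
      ... | no p≮a  = contradiction (s≤s (m≤n+m p r)) p≮a
      ... | yes p<a with lookup x (fromℕ< p<a) in eq
      ...   | outside = evaluate-A r (suc p) x g (+-suc r p) (λ h h≈ →
                K h (≈-trans h≈ (≈-reflexive (cong (g ∙_) (sym (π-from-outside p A x p<a eq))))))
      ...   | inside  = evaluate-A r (suc p) x _ (+-suc r p) (λ h h≈ →
                K h (≈-trans h≈ (≈-trans (assoc g _ _)
                  (≈-reflexive (cong (g ∙_) (sym (π-from-inside p A x p<a eq)))))))

    -- Multiplying inverses on the left builds up the inverse of the product. Each position is
    -- allotted two steps, an inversion and a multiplication; a position outside y takes only one.
    evaluate-B : ∀ r p y g → r + p ≡ b →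
      (∀ h → h ≈ z ∙ (π-from p B y ⁻¹ ∙ g) → Run η o k (resume η κ (inj₂ y) h)) →
      Run η o (suc (r + r) + k) (evaluate κ (inj₂ y) p g)
    evaluate-B zero p y g refl K =
      evaluating (evaluate-storage κ (inj₂ y) κ≤ (m≤n+m b a)) done
      where
      done : Run η o k (proj₂ (step η (evaluate κ (inj₂ y) p g)))
      done with p <? b
      ... | yes p<b = contradiction p<b (<-irrefl refl)
      ... | no _    = K (z ∙ g) (∙-congˡ (≈-sym (≈-trans
                        (∙-congʳ (≈-trans (⁻¹-cong (π-from-end B y)) ε⁻¹≈ε)) (identityˡ g))))
    evaluate-B (suc r) p y g refl K =
      evaluating (evaluate-storage κ (inj₂ y) κ≤ p≤)
        (subst (λ s → Run η o s (proj₂ (step η (evaluate κ (inj₂ y) p g))))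
          (cong (λ t → suc (t + k)) (sym (+-suc r r))) next)
      where
      p≤ : p ≤ a + b
      p≤ = ≤-trans (m≤n+m p (suc r)) (m≤n+m b a)
      next : Run η o (suc (suc (r + r) + k)) (proj₂ (step η (evaluate κ (inj₂ y) p g)))
      next with p <? b
      ... | no p≮b  = contradiction (s≤s (m≤n+m p r)) p≮b
      ... | yes p<b with lookup y (fromℕ< p<b) in eq
      ...   | outside = weaken (n≤1+n _) (evaluate-B r (suc p) y g (+-suc r p) (λ h h≈ →
                K h (≈-trans h≈ (≈-reflexive
                  (cong (λ t → z ∙ (t ⁻¹ ∙ g)) (sym (π-from-outside p B y p<b eq)))))))
      ...   | inside  = multiplying (multiply-storage κ (inj₂ y) κ≤ p≤)
                (evaluate-B r (suc p) y _ (+-suc r p) (λ h h≈ → K h (≈-trans h≈ (∙-congˡ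
                  (≈-trans (≈-sym (assoc _ _ g)) (∙-congʳ (≈-trans (≈-sym (⁻¹-anti-homo-∙ _ _))
                    (⁻¹-cong (≈-reflexive (sym (π-from-inside p B y p<b eq)))))))))))

  -- A bound on the number of steps of one evaluation.
  M : ℕ
  M = suc ((a + b) + (a + b))

  -- The machine's product agrees with `value v` up to `≈` only, so the continuation must accept
  -- every such h. This is harmless because later steps use h only through its identifier.
  call-value : ∀ η {o k} κ v → frameStorage κ ≤ frameBound →
    (∀ h → h ≈ value v → Run η o k (resume η κ v h)) → Run η o (M + k) (call κ v)
  call-value η {k = k} κ (inj₁ x) κ≤ K =
    weaken (+-monoˡ-≤ k (s≤s (≤-trans (m≤m+n a b) (m≤m+n _ _))))
      (Evaluation.evaluate-A η κ κ≤ a 0 x ε (+-identityʳ a) (λ h h≈ → K h (≈-trans h≈ (identityˡ _))))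
  call-value η {k = k} κ (inj₂ y) κ≤ K =
    weaken (+-monoˡ-≤ k (s≤s (+-mono-≤ (m≤n+m b a) (m≤n+m b a))))
      (Evaluation.evaluate-B η κ κ≤ b 0 y ε (+-identityʳ b)
        (λ h h≈ → K h (≈-trans h≈ (∙-congˡ (identityʳ _)))))

  module Round (η : Oracle n a b) where

    φ : C → C
    φ v = lookup η (label v)

    ⟨⟩-cong : ∀ {g h} → g ≈ h → η ⟨ g ⟩ ≡ η ⟨ h ⟩
    ⟨⟩-cong g≈h = cong (lookup η) (Inverse.from-cong enumeration g≈h)

    call-φ : ∀ {o k} κ v (next : C → Config) → frameStorage κ ≤ frameBound →
      (∀ h → resume η κ v h ≡ next (η ⟨ h ⟩)) → Run η o k (next (φ v)) → Run η o (M + k) (call κ v)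
    call-φ {o} {k} κ v next κ≤ eq run = call-value η κ v κ≤ (λ h h≈ →
      subst (Run η o k) (sym (trans (eq h) (cong next (⟨⟩-cong h≈)))) run)

    Success : C → C → Set ℓ
    Success s t = value s ≈ value t × opposite s t ≡ true

    decide-run : ∀ {o k} s t → value s ≈ value t → o ≡ 0 ⊎ Success s t → Run η o k (decide s t)
    decide-run (inj₁ x) (inj₂ y) s≈t _ = solved (x , y , refl ,
      ≈-trans (∙-congʳ s≈t) (//-rightDividesˡ (π (subsequence B y)) z))
    decide-run (inj₂ y) (inj₁ x) s≈t _ = solved (x , y , refl ,
      ≈-trans (∙-congʳ (≈-sym s≈t)) (//-rightDividesˡ (π (subsequence B y)) z))
    decide-run (inj₁ _) (inj₁ _) s≈t (inj₁ o≡0) = halted o≡0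
    decide-run (inj₂ _) (inj₂ _) s≈t (inj₁ o≡0) = halted o≡0
    decide-run (inj₁ _) (inj₁ _) s≈t (inj₂ (_ , ()))
    decide-run (inj₂ _) (inj₂ _) s≈t (inj₂ (_ , ()))

    two-values : ℕ
    two-values = suc (a + b) + suc (a + b)

    two-values≤ : ∀ x y → ∣ x ∣ᶜ + ∣ y ∣ᶜ ≤ frameBound
    two-values≤ x y = ≤-trans (+-mono-≤ (∣v∣≤ x) (∣v∣≤ y)) (≤-trans (m≤m+n _ _) (m≤m+n _ _))

    one-counter≤ : ∀ x y {j} → j ≤ suc n → ∣ x ∣ᶜ + ∣ y ∣ᶜ + ∣ j ∣ⁿ ≤ frameBound
    one-counter≤ x y j≤ = ≤-trans (+-mono-≤ (+-mono-≤ (∣v∣≤ x) (∣v∣≤ y))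
      (≤-trans (counter≤ j≤) (m≤m+n counterBound counterBound))) (m≤m+n _ _)

    two-counters≤ : ∀ x y {i j} → j ≤ suc n → i ≤ suc n →
                    ∣ x ∣ᶜ + ∣ y ∣ᶜ + ∣ j ∣ⁿ + ∣ i ∣ⁿ ≤ frameBound
    two-counters≤ x y {i} {j} j≤ i≤ = ≤-trans (≤-reflexive (+-assoc (∣ x ∣ᶜ + ∣ y ∣ᶜ) (∣ j ∣ⁿ) (∣ i ∣ⁿ)))
      (≤-trans (+-mono-≤ (+-mono-≤ (∣v∣≤ x) (∣v∣≤ y)) (+-mono-≤ (counter≤ j≤) (counter≤ i≤))) (m≤m+n _ _))

    value-and-element≤ : ∀ x → ∣ x ∣ᶜ + ∣element∣ ≤ frameBound
    value-and-element≤ x = +-monoˡ-≤ ∣element∣ (≤-trans (∣v∣≤ x) (≤-trans (m≤m+n _ _) (m≤m+n _ _)))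

    compare-run : ∀ {o k} s t → o ≡ 0 ⊎ Success s t → Run η o (M + (M + k)) (call (value-s t) s)
    compare-run {o} {k} s t outcome =
      call-value η (value-s t) s (≤-trans (m≤m+n _ _) (two-values≤ t t)) (λ h h≈s →
      call-value η (value-t s h) t (value-and-element≤ s) (λ g g≈t → check h g h≈s g≈t outcome))
      where
      check : ∀ h g → h ≈ value s → g ≈ value t → o ≡ 0 ⊎ Success s t →
              Run η o k (resume η (value-t s h) t g)
      check h g h≈s g≈t outcome with identifier h Fin.≟ identifier g
      ... | yes p = decide-run s t (≈-trans (≈-sym h≈s) (≈-trans (identifier-injective p) g≈t)) outcome
      ... | no ¬p with outcome
      ...   | inj₁ o≡0       = halted o≡0
      ...   | inj₂ (s≈t , _) = contradiction
                (Inverse.from-cong enumeration (≈-trans h≈s (≈-trans s≈t (≈-sym g≈t)))) ¬p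

    module Floyd {w : C} {μ p : ℕ} (ρ : Rho φ w μ p) (p+μ≤ : p + μ ≤ suc n) where
      open Rho ρ

      x : ℕ → C
      x = orbit φ w

      μ≤ : μ ≤ suc n
      μ≤ = ≤-trans (m≤n+m μ p) p+μ≤

      p≤ : p ≤ suc n
      p≤ = ≤-trans (m≤m+n p μ) p+μ≤

      find-s-run : ∀ {o k} t r m → r ≤ suc n → Run η o k (call (value-s t) (x (r + m))) →
                   Run η o (r * M + k) (find-s t r (x m))
      find-s-run t zero    m r≤ run = run
      find-s-run {o} {k} t (suc r) m r≤ run =
        resteps (sym (+-assoc M (r * M) k))
          (call-φ (advance-s t r) (x m) (find-s t r)
            (≤-trans (+-monoˡ-≤ (∣ r ∣ⁿ) (m≤m+n (∣ t ∣ᶜ) (∣ t ∣ᶜ))) (one-counter≤ t t (<⇒≤ r≤)))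
            (λ _ → refl)
            (find-s-run t r (suc m) (<⇒≤ r≤)
              (subst (λ i → Run η o k (call (value-s t) (x i))) (sym (+-suc r m)) run)))

      find-t-run : ∀ {o k} i r m → i ≤ suc n → r ≤ suc n → Run η o k (find-s (x (r + m)) i (x (r + m))) →
                   Run η o (r * M + k) (find-t i r (x m))
      find-t-run i zero    m i≤ r≤ run = run
      find-t-run {o} {k} i (suc r) m i≤ r≤ run =
        resteps (sym (+-assoc M (r * M) k))
          (call-φ (advance-t i r) (x m) (find-t i r)
            (≤-trans (+-mono-≤ (counter≤ i≤) (counter≤ (<⇒≤ r≤)))
              (≤-trans (m≤n+m _ two-values) (m≤m+n _ _)))
            (λ _ → refl)
            (find-t-run i r (suc m) i≤ (<⇒≤ r≤)
              (subst (λ i′ → Run η o k (find-s (x i′) i (x i′))) (sym (+-suc r m)) run)))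

      -- With `o ≡ 0` nothing is promised; otherwise the two predecessors of the entrance to the
      -- cycle must give a solution, and in particular there must be a tail.
      Outcome : ℕ → Set ℓ
      Outcome o = o ≡ 0 ⊎ ∃[ j ] μ ≡ suc j × Success (x (p + j)) (x j)

      restartOrFind-run : ∀ {o} → Outcome o →
        Run η o (μ * M + (p * M + (M + (M + 0)))) (restartOrFind w p μ)
      restartOrFind-run {o} = cases μ refl
        where
        success : ∀ j → μ ≡ suc j → Outcome o → o ≡ 0 ⊎ Success (x (p + j)) (x j)
        success j eq (inj₁ o≡0)             = inj₁ o≡0
        success j eq (inj₂ (j′ , eq′ , ok)) =
          inj₂ (subst (λ i → Success (x (p + i)) (x i)) (suc-injective (trans (sym eq′) eq)) ok)
        cases : ∀ m → μ ≡ m → Outcome o → Run η o (m * M + (p * M + (M + (M + 0)))) (restartOrFind w p m)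
        cases zero μ≡0 (inj₁ o≡0) = halted o≡0
        cases zero μ≡0 (inj₂ (_ , μ≡1+j , _)) with () ← trans (sym μ≡0) μ≡1+j
        cases (suc j) eq outcome = weaken (+-monoˡ-≤ _ (m≤n+m (j * M) M))
          (find-t-run p j 0 p≤ (<⇒≤ (≤-trans (≤-reflexive (sym eq)) μ≤))
            (find-s-run _ p (j + 0) p≤ (subst (λ i → Run η o (M + (M + 0)) (call (value-s (x i)) (x (p + i))))
              (sym (+-identityʳ j)) (compare-run _ _ (success j eq outcome)))))

      -- `r` counts the remaining iterations. An earlier stop is impossible, since by `repetition` a
      -- return to x μ takes a multiple of p steps.
      findCycle-run : ∀ {o k} r i → r + suc i ≡ p →
        Run η o k (restartOrFind w p μ) → Run η o (r * M + k) (findCycle w (x μ) (x (suc i + μ)) μ (suc i))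
      findCycle-run {o} {k} r i r+i≡p run with x (suc i + μ) ≟ x μ
      ... | yes eq = weaken (m≤n+m k (r * M))
            (subst (λ i → Run η o k (restartOrFind w i μ)) (sym suc-i≡p) run)
        where
        suc-i≡p : suc i ≡ p
        suc-i≡p with _ , q , eq′ ← repetition (m<n+m μ z<s) (sym eq) =
          ≤-antisym (≤-trans (m≤n+m (suc i) r) (≤-reflexive r+i≡p))
            (≤-trans (m≤m+n p (q * p)) (≤-reflexive (sym (+-cancelʳ-≡ μ (suc i) (suc q * p) eq′))))
      findCycle-run zero    i refl   run | no neq = contradiction closed neq
      findCycle-run {o} {k} (suc r) i r+i≡p run | no neq =
        resteps (sym (+-assoc M (r * M) k))
          (call-φ (cycle w (x μ) μ (suc i)) _ (λ y → findCycle w (x μ) y μ (suc (suc i)))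
            (two-counters≤ w (x μ) μ≤ (≤-trans (m≤n+m (suc i) (suc r)) (≤-trans (≤-reflexive r+i≡p) p≤)))
            (λ _ → refl)
            (findCycle-run r (suc i) (trans (+-suc r (suc i)) r+i≡p) run))

      cycle-run : ∀ {o k} → Run η o k (restartOrFind w p μ) →
                  Run η o (p * M + k) (call (cycle w (x μ) μ 0) (x μ))
      cycle-run {o} {k} run =
        resteps (trans (sym (+-assoc M (pred p * M) k)) (cong (λ p → p * M + k) (suc-pred p)))
          (call-φ (cycle w (x μ) μ 0) (x μ) (λ y → findCycle w (x μ) y μ 1)
            (two-counters≤ w (x μ) μ≤ z≤n) (λ _ → refl)
            (findCycle-run (pred p) 0 (trans (+-comm (pred p) 1) (suc-pred p)) run))

      module _ {d : ℕ} (0<d : 0 < d) (meets : x μ ≡ x (μ + d)) where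

        -- By `repetition` the two pointers cannot agree before index μ, and by `meets` they do
        -- agree there.
        findTail-run : ∀ {o k} r j → r + j ≡ μ → Run η o k (call (cycle w (x μ) μ 0) (x μ)) →
                       Run η o (r * (M + M) + k) (findTail w (x j) (x (j + d)) j)
        findTail-run {o} {k} r j r+j≡μ run with x j ≟ x (j + d)
        ... | yes eq = weaken (m≤n+m k (r * (M + M)))
              (subst (λ j → Run η o k (call (cycle w (x j) j 0) (x j))) (sym j≡μ) run)
          where
          j≡μ : j ≡ μ
          j≡μ = ≤-antisym (≤-trans (m≤n+m j r) (≤-reflexive r+j≡μ))
                  (proj₁ (repetition (m<m+n j 0<d) eq))
        findTail-run zero    j refl  run | no neq = contradiction meets neq
        findTail-run {o} {k} (suc r) j r+j≡μ run | no neq =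
          resteps (trans (sym (+-assoc M M _)) (sym (+-assoc (M + M) (r * (M + M)) k)))
            (call-φ (tail₁ w _ j) (x j) (λ x′ → call (tail₂ w x′ j) (x (j + d)))
              (one-counter≤ w _ j≤) (λ _ → refl)
              (call-φ (tail₂ w _ j) (x (j + d)) (λ y → findTail w (x (suc j)) y (suc j))
                (one-counter≤ w _ j≤) (λ _ → refl)
                (findTail-run r (suc j) (trans (+-suc r j) r+j≡μ) run)))
          where
          j≤ : j ≤ suc n
          j≤ = ≤-trans (m≤n+m j (suc r)) (≤-trans (≤-reflexive r+j≡μ) μ≤)

      tortoise-run : ∀ {o k} i → Run η o k (meet w (x (suc i)) (x (suc i + suc i))) →
                     Run η o (M + (M + (M + k))) (call (tortoise w (x (i + i))) (x i))
      tortoise-run {o} {k} i run =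
        call-φ (tortoise w _) (x i) (λ x′ → call (hare₁ w x′) (x (i + i))) (two-values≤ w _) (λ _ → refl)
          (call-φ (hare₁ w _) (x (i + i)) (λ y → call (hare₂ w (x (suc i))) y) (two-values≤ w _) (λ _ → refl)
            (call-φ (hare₂ w _) (x (suc (i + i))) (λ y → meet w (x (suc i)) y) (two-values≤ w _) (λ _ → refl)
              (subst (λ j → Run η o k (meet w (x (suc i)) (x (suc j)))) (+-suc i i) run)))

      -- The given N only bounds the search. The machine may meet earlier, so the continuation has
      -- to accept every meeting index.
      meet-run : ∀ {o k} r i {N} → r + suc i ≡ N → x N ≡ x (N + N) →
        (∀ N → 0 < N → x N ≡ x (N + N) → Run η o k (findTail w w (x (N + N)) 0)) →
        Run η o (r * (M + (M + M)) + k) (meet w (x (suc i)) (x (suc i + suc i)))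
      meet-run {o} {k} r i r+i≡N eqN K with x (suc i) ≟ x (suc i + suc i)
      ... | yes eq = weaken (m≤n+m k _) (K (suc i) z<s eq)
      meet-run zero    i refl  eqN K | no neq = contradiction eqN neq
      meet-run {o} {k} (suc r) i r+i≡N eqN K | no neq =
        resteps (regroup M (r * (M + (M + M))) k)
          (tortoise-run (suc i) (meet-run r (suc i) (trans (+-suc r (suc i)) r+i≡N) eqN K))
        where
        regroup : ∀ M s k → M + (M + (M + (s + k))) ≡ M + (M + M) + s + k
        regroup = solve-∀

      -- Evaluations of π: 3 (p + μ) + 3 suffice for the meeting, 2 μ for the tail, p for the cycle,
      -- μ and p to reach t and s, and 2 for the comparison. The total 5 p + 6 μ + 5 is rounded up
      -- to a multiple of p + μ, plus 5.
      round-run : ∀ {o} → Outcome o → Run η o (M * (8 * (p + μ) + 5)) (call (tortoise w w) w)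
      round-run {o} outcome with N , 0<N , N≤ , eqN ← meeting =
        weaken steps≤ (tortoise-run 0 (meet-run (pred N) 0
          (trans (+-comm (pred N) 1) (suc-pred N {{>-nonZero 0<N}})) eqN
          (λ N′ 0<N′ eq → findTail-run (≤-trans 0<N′ (m≤m+n N′ N′)) (meets 0<N′ eq) μ 0 (+-identityʳ μ)
            (cycle-run (restartOrFind-run outcome)))))
        where
        -- The tail search starts with one pointer at w and the other at x (N + N). Their distance 2
        -- N is a multiple of p because N is.
        meets : ∀ {N} → 0 < N → x N ≡ x (N + N) → x μ ≡ x (μ + (N + N))
        meets {N} 0<N eq with _ , q , eq′ ← repetition (m<m+n N 0<N) eq = begin
          x μ                              ≡⟨ periodic* (suc q + suc q) 0 ⟨
          x ((suc q + suc q) * p + μ)      ≡⟨ cong x (+-comm _ μ) ⟩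
          x (μ + (suc q + suc q) * p)      ≡⟨ cong (λ s → x (μ + s)) (*-distribʳ-+ p (suc q) (suc q)) ⟩
          x (μ + (suc q * p + suc q * p))  ≡⟨ cong (λ s → x (μ + (s + s))) (+-cancelʳ-≡ N N (suc q * p) eq′) ⟨
          x (μ + (N + N))                  ∎
          where open ≡-Reasoning
        after-meeting : ℕ
        after-meeting = μ * (M + M) + (p * M + (μ * M + (p * M + (M + (M + 0)))))
        steps≤ : M + (M + (M + (pred N * (M + (M + M)) + after-meeting))) ≤ M * (8 * (p + μ) + 5)
        steps≤ = begin
          M + (M + (M + (pred N * (M + (M + M)) + after-meeting)))
            ≤⟨ +-monoʳ-≤ M (+-monoʳ-≤ M (+-monoʳ-≤ M
                 (+-monoˡ-≤ after-meeting (*-monoˡ-≤ (M + (M + M)) (≤-trans pred[n]≤n N≤))))) ⟩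
          M + (M + (M + ((p + μ) * (M + (M + M)) + after-meeting)))
            ≤⟨ m≤m+n _ (M * (3 * p + 2 * μ)) ⟩
          M + (M + (M + ((p + μ) * (M + (M + M)) + after-meeting))) + M * (3 * p + 2 * μ)
            ≡⟨ regroup M p μ ⟩
          M * (8 * (p + μ) + 5) ∎
          where
          open ≤-Reasoning
          regroup : ∀ M p μ →
            M + (M + (M + ((p + μ) * (M + (M + M)) +
              (μ * (M + M) + (p * M + (μ * M + (p * M + (M + (M + 0))))))))) + M * (3 * p + 2 * μ)
            ≡ M * (8 * (p + μ) + 5)
          regroup = solve-∀

-- From the random walk to the machine

does-true : ∀ {p} {P : Set p} (P? : Dec P) → does P? ≡ true → P
does-true (yes p) _ = p

does-false : ∀ {p} {P : Set p} (P? : Dec P) → does P? ≡ false → ¬ P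
does-false (no ¬p) _ = ¬p

module _ {ℓ} {X : Set ℓ} (P : X → Bool) (x : ℕ → X) where

  any-applyDownFrom⁻ : ∀ t → any P (applyDownFrom x t) ≡ true → ∃[ j ] j < t × P (x j) ≡ true
  any-applyDownFrom⁻ (suc t) p with P (x t) in eq
  ... | true  = t , ≤-refl , eq
  ... | false with j , j<t , q ← any-applyDownFrom⁻ t p = j , m<n⇒m<1+n j<t , q

  none-applyDownFrom⁻ : ∀ t → any P (applyDownFrom x t) ≡ false → ∀ {j} → j < t → P (x j) ≡ false
  none-applyDownFrom⁻ (suc t) p {j} (s≤s j≤t) with P (x t) in eq
  ... | false with m≤n⇒m<n∨m≡n j≤t
  ...   | inj₁ j<t  = none-applyDownFrom⁻ t p j<t
  ...   | inj₂ refl = eq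

module Rounds {c ℓ n} (G : FiniteGroup c ℓ n) {a b : ℕ}
              (A : Vec (FiniteGroup.Carrier G) a) (B : Vec (FiniteGroup.Carrier G) b)
              (z : FiniteGroup.Carrier G) where
  open Machine G A B z public
  open Walk {C} {n} label opposite public

  opposite-sym : ∀ s t → opposite s t ≡ opposite t s
  opposite-sym (inj₁ _) (inj₁ _) = refl
  opposite-sym (inj₁ _) (inj₂ _) = refl
  opposite-sym (inj₂ _) (inj₁ _) = refl
  opposite-sym (inj₂ _) (inj₂ _) = refl

  opposite-irrefl : ∀ {s t} → opposite s t ≡ true → s ≢ t
  opposite-irrefl {inj₁ _} () refl
  opposite-irrefl {inj₂ _} () refl

  duration≤ : ∀ k V v η → duration k V v η ≤ k
  duration≤ zero    V v η = z≤n
  duration≤ (suc k) V v η with hit V (label v)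
  ... | true  = z≤n
  ... | false = s≤s (duration≤ k (v ∷ V) _ η)

  success≤1 : ∀ k V v η → success k V v η ≤ 1
  success≤1 zero    V v η = 𝟙≤1 (good V v)
  success≤1 (suc k) V v η with hit V (label v)
  ... | true  = 𝟙≤1 (good V v)
  ... | false = success≤1 k (v ∷ V) _ η

  module _ (w : C) (η : Oracle n a b) where
    open Round η

    x : ℕ → C
    x = orbit φ w

    HasRho : ℕ → ℕ → Set ℓ
    HasRho bound o = ∃₂ λ μ p → Rho φ w μ p × p + μ ≤ bound ×
                     (o ≡ 0 ⊎ ∃[ j ] μ ≡ suc j × Success (x (p + j)) (x j))

    module _ {t : ℕ} (new : ∀ {i j} → i < j → j < t → label (x i) ≢ label (x j)) where

      -- When the element itself recurs, the cycle is entered at j, and the predecessors of the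
      -- entrance, if j > 0, have different labels. Hence this case promises no success.
      repeat-value : ∀ {j} → j < t → x j ≡ x t → Rho φ w j (t ∸ j)
      repeat-value {j} j<t eq = record
        { p≢0      = >-nonZero (m<n⇒0<n∸m j<t)
        ; closed   = trans (cong x (m∸n+n≡m (<⇒≤ j<t))) (sym eq)
        ; distinct = λ i<i′ i′< eq′ → new i<i′ (subst (_ <_) (m∸n+n≡m (<⇒≤ j<t)) i′<) (cong label eq′)
        }

      -- Distinct elements with the same label have the same image under φ, so the cycle is entered
      -- at j + 1, and the s and t of the algorithm are x t and x j.
      repeat-label : ∀ {j} → j < t → label (x j) ≡ label (x t) → x j ≢ x t → Rho φ w (suc j) (t ∸ j)
      repeat-label {j} j<t eq neq = record
        { p≢0      = >-nonZero (m<n⇒0<n∸m j<t)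
        ; closed   = trans (cong x t∸j+1+j) (cong (lookup η) (sym eq))
        ; distinct = distinct
        }
        where
        t∸j+1+j : t ∸ j + suc j ≡ suc t
        t∸j+1+j = trans (+-suc (t ∸ j) j) (cong suc (m∸n+n≡m (<⇒≤ j<t)))
        label-injective : ∀ {i} → i < t → label (x i) ≡ label (x j) → i ≡ j
        label-injective {i} i<t eq′ with <-cmp i j
        ... | tri< i<j _ _ = contradiction eq′ (new i<j j<t)
        ... | tri≈ _ i≡j _ = i≡j
        ... | tri> _ _ j<i = contradiction (sym eq′) (new j<i i<t)
        distinct : ∀ {i i′} → i < i′ → i′ < t ∸ j + suc j → x i ≢ x i′
        distinct {i} {i′} i<i′ i′< eq′ with m≤n⇒m<n∨m≡n (s≤s⁻¹ (subst (i′ <_) t∸j+1+j i′<))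
        ... | inj₁ i′<t = new i<i′ i′<t (cong label eq′)
        ... | inj₂ refl with refl ← label-injective i<i′ (trans (cong label eq′) (sym eq)) = neq eq′

      failure : ∀ {j} → j < t → label (x j) ≡ label (x t) → HasRho (suc t) 0
      failure {j} j<t eq with x j ≟ x t
      ... | yes p = j , t ∸ j , repeat-value j<t p ,
                    ≤-trans (≤-reflexive (m∸n+n≡m (<⇒≤ j<t))) (n≤1+n t) , inj₁ refl
      ... | no ¬p = suc j , t ∸ j , repeat-label j<t eq ¬p ,
                    ≤-reflexive (trans (+-suc (t ∸ j) j) (cong suc (m∸n+n≡m (<⇒≤ j<t)))) , inj₁ refl

      finish : ∀ {j} → j < t → label (x j) ≡ label (x t) →
               HasRho (suc t) (𝟙 (good (applyDownFrom x t) (x t)))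
      finish j<t eq with good (applyDownFrom x t) (x t) in is-good
      ... | false = failure j<t eq
      ... | true with i , i<t , i-good ← any-applyDownFrom⁻ _ x t is-good
                 with p , q ← ∧-true i-good =
        suc i , t ∸ i , repeat-label i<t (does-true (_ Fin.≟ _) p) (opposite-irrefl q) ,
        ≤-reflexive (trans (+-suc (t ∸ i) i) (cong suc (m∸n+n≡m (<⇒≤ i<t)))) ,
        inj₂ (i , refl , subst (λ s → Success s (x i)) (cong x (sym (m∸n+n≡m (<⇒≤ i<t))))
          (identifier-injective (sym (does-true (_ Fin.≟ _) p)) , trans (opposite-sym (x t) (x i)) q))

    -- Here V lists x 0, ..., x (t - 1), whose labels are distinct. When the fuel is spent, t is n,
    -- and the pigeonhole principle makes the label of x t a repetition, so that the walk rightly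
    -- ends there.
    walk-rho : ∀ k t → k + t ≡ n → (∀ {i j} → i < j → j < t → label (x i) ≢ label (x j)) →
      HasRho (suc (duration k (applyDownFrom x t) (x t) η + t)) (success k (applyDownFrom x t) (x t) η)
    walk-rho zero t refl new with Fin.pigeonhole ≤-refl (λ i → label (x (toℕ {suc t} i)))
    ... | i , j , i<j , eq with m≤n⇒m<n∨m≡n (Fin.toℕ≤pred[n] j)
    ...   | inj₁ j<t = contradiction eq (new i<j j<t)
    ...   | inj₂ j≡t = finish new (subst (toℕ i <_) j≡t i<j) (trans eq (cong (label ∘ x) j≡t))
    walk-rho (suc k) t k+t≡n new with hit (applyDownFrom x t) (label (x t)) in is-hit
    ... | true with j , j<t , p ← any-applyDownFrom⁻ _ x t is-hit = finish new j<t (does-true (_ Fin.≟ _) p)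
    ... | false = subst (λ s → HasRho (suc s) (success k (applyDownFrom x (suc t)) (x (suc t)) η))
                    (+-suc (duration k (applyDownFrom x (suc t)) (x (suc t)) η) t)
                    (walk-rho k (suc t) (trans (+-suc k t) k+t≡n) new′)
      where
      new′ : ∀ {i j} → i < j → j < suc t → label (x i) ≢ label (x j)
      new′ i<j (s≤s j≤t) with m≤n⇒m<n∨m≡n j≤t
      ... | inj₁ j<t  = new i<j j<t
      ... | inj₂ refl = does-false (_ Fin.≟ _) (none-applyDownFrom⁻ _ x t is-hit i<j)

    draw-run : Run η (success n [] w η) (M * (8 * suc (duration n [] w η) + 5)) (call (tortoise w w) w)
    draw-run with walk-rho n 0 (+-identityʳ n) (λ _ ())
    ... | μ , p , ρ , p+μ≤ , outcome =
      weaken (*-monoʳ-≤ M (+-monoˡ-≤ 5 (*-monoʳ-≤ 8 p+μ≤′)))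
        (Floyd.round-run ρ (≤-trans p+μ≤′ (s≤s (duration≤ n [] w η))) outcome)
      where
      p+μ≤′ : p + μ ≤ suc (duration n [] w η)
      p+μ≤′ = ≤-trans p+μ≤ (≤-reflexive (cong suc (+-identityʳ _)))

  successes steps : Draw n a b → ℕ
  successes (w , η) = success n [] w η
  steps     (w , η) = M * (8 * suc (duration n [] w η) + 5)

  Acceptable : Config → Set (c Level.⊔ ℓ)
  Acceptable C = storage C ≤ storageBound × (∀ u → C ≡ output u → Solution u)

  mutual
    run-acceptable : ∀ {m} t (ds : Vec (Draw n a b) m) → Acceptable (configuration t ds)
    run-acceptable zero    ds             = z≤n , λ _ ()
    run-acceptable (suc t) []             = z≤n , λ _ ()
    run-acceptable (suc t) ((w , η) ∷ ds) = continue-acceptable t ds (draw-run w η)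

    continue-acceptable : ∀ {m} t (ds : Vec (Draw n a b) m) {η o k C} → Run η o k C →
                          Acceptable (proj₂ (continue t ds η C))
    continue-acceptable t       ds (halted _)            = run-acceptable t ds
    continue-acceptable zero    ds (solved s)            = a+b≤ , λ { _ refl → s }
      where
      a+b≤ : a + b ≤ storageBound
      a+b≤ = ≤-trans (m≤n+m (a + b) (frameBound + suc (a + b))) (m≤m+n _ (∣element∣ + ∣element∣))
    continue-acceptable (suc t) ds {η} {o} {k} (solved s) = continue-acceptable t ds {η} {o} {k} (solved s)
    continue-acceptable zero    ds (evaluating st run)   = st , λ _ ()
    continue-acceptable (suc t) ds (evaluating st run)   = continue-acceptable t ds run
    continue-acceptable zero    ds (multiplying st run)  = st , λ _ ()
    continue-acceptable (suc t) ds (multiplying st run)  = continue-acceptable t ds run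

  step≤1 : ∀ η C → proj₁ (step η C) ≤ 1
  step≤1 η (evaluate κ (inj₁ x) p g) with p <? a
  ... | no  _   = z≤n
  ... | yes p<a with lookup x (fromℕ< p<a)
  ...   | outside = z≤n
  ...   | inside  = ≤-refl
  step≤1 η (evaluate κ (inj₂ y) p g) with p <? b
  ... | no  _   = ≤-refl
  ... | yes p<b with lookup y (fromℕ< p<b)
  ...   | outside = z≤n
  ...   | inside  = ≤-refl
  step≤1 η (multiply κ v p g h) = ≤-refl
  step≤1 η restart              = z≤n
  step≤1 η (output u)           = z≤n

  continue-output : ∀ {m} t (ds : Vec (Draw n a b) m) η u → continue t ds η (output u) ≡ (0 , output u)
  continue-output zero    ds η u = refl
  continue-output (suc t) ds η u = continue-output t ds η u

  -- `t′` is the fuel left for the later rounds. It depends on the current draw only, so the bound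
  -- can be summed over `ds`; the factor `1 ∸ o` drops the later rounds after a success.
  continue-operations : ∀ t {η o k C} → Run η o k C → ∃[ t′ ] ∀ {m} (ds : Vec (Draw n a b) m) →
    proj₁ (continue t ds η C) ≤ k + (1 ∸ o) * operations t′ ds
  continue-operations t {k = k} (halted refl) =
    t , λ ds → m≤n⇒m≤o+n k (≤-reflexive (sym (*-identityˡ _)))
  continue-operations t {η} (solved {u = u} s) =
    0 , λ ds → ≤-trans (≤-reflexive (cong proj₁ (continue-output t ds η u))) z≤n
  continue-operations zero (evaluating st run) = 0 , λ _ → z≤n
  continue-operations (suc t) {η} {C = C} (evaluating st run) with t′ , ops≤ ← continue-operations t run =
    t′ , λ ds → +-mono-≤ (step≤1 η C) (ops≤ ds)
  continue-operations zero (multiplying st run) = 0 , λ _ → z≤n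
  continue-operations (suc t) {η} {C = C} (multiplying st run) with t′ , ops≤ ← continue-operations t run =
    t′ , λ ds → +-mono-≤ (step≤1 η C) (ops≤ ds)

  run-operations : ∀ t d → ∃[ t′ ] ∀ {m} (ds : Vec (Draw n a b) m) →
    operations t (d ∷ ds) ≤ steps d + (1 ∸ successes d) * operations t′ ds
  run-operations zero    d       = 0 , λ _ → z≤n
  run-operations (suc t) (w , η) = continue-operations t (draw-run w η)

  continue-ends : ∀ {m} {t r} (ds : Vec (Draw n a b) m) {η o k C} → Run η o k C → k + r ≤ t →
    (∃[ u ] proj₂ (continue t ds η C) ≡ output u) ⊎
    (o ≡ 0 × ∃[ t′ ] r ≤ t′ × proj₂ (continue t ds η C) ≡ configuration t′ ds)
  continue-ends {t = t} ds {k = k} (halted o≡0) k+r≤t =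
    inj₂ (o≡0 , t , ≤-trans (m≤n+m _ k) k+r≤t , refl)
  continue-ends {t = t} ds {η} (solved {u = u} s) k+r≤t =
    inj₁ (u , cong proj₂ (continue-output t ds η u))
  continue-ends ds (evaluating st run)  (s≤s k+r≤t) = continue-ends ds run k+r≤t
  continue-ends ds (multiplying st run) (s≤s k+r≤t) = continue-ends ds run k+r≤t

  -- The indicator that every draw fails, written as a product so that its sum over independent
  -- draws is a power.
  failures : ∀ {m} → Vec (Draw n a b) m → ℕ
  failures []       = 1
  failures (d ∷ ds) = (1 ∸ successes d) * failures ds

  -- The additional unit is the fuel that `run` spends on starting a round.
  lastStep roundBound : ℕ
  lastStep   = M * (8 * suc n + 5)
  roundBound = suc lastStep

  steps≤ : ∀ d → steps d ≤ lastStep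
  steps≤ (w , η) = *-monoʳ-≤ M (+-monoˡ-≤ 5 (*-monoʳ-≤ 8 (s≤s (duration≤ n [] w η))))

  run-ends : ∀ {m} t (ds : Vec (Draw n a b) m) → m * roundBound ≤ t →
             (∃[ u ] configuration t ds ≡ output u) ⊎ 1 ≤ failures ds
  run-ends t [] _ = inj₂ ≤-refl
  run-ends {suc m} (suc t) ((w , η) ∷ ds) (s≤s t≥) =
    [ inj₁ , (λ (o≡0 , t′ , m≤t′ , eq) → later o≡0 eq (run-ends t′ ds m≤t′)) ]′
      (continue-ends ds (weaken (steps≤ (w , η)) (draw-run w η)) t≥)
    where
    later : ∀ {o C D} → o ≡ 0 → C ≡ D → (∃[ u ] D ≡ output u) ⊎ 1 ≤ failures ds →
            (∃[ u ] C ≡ output u) ⊎ 1 ≤ (1 ∸ o) * failures ds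
    later refl refl (inj₁ out)  = inj₁ out
    later refl refl (inj₂ fail) = inj₂ (≤-trans fail (≤-reflexive (sym (*-identityˡ _))))

-- Averages over the draws

^-distribʳ-* : ∀ x y m → (x * y) ^ m ≡ x ^ m * y ^ m
^-distribʳ-* x y zero    = refl
^-distribʳ-* x y (suc m) = trans (cong (x * y *_) (^-distribʳ-* x y m)) (regroup x y (x ^ m) (y ^ m))
  where
  regroup : ∀ x y p q → x * y * (p * q) ≡ x * p * (y * q)
  regroup = solve-∀

bernoulli : ∀ m → 13 ^ m * (13 + m) ≤ 13 * 14 ^ m
bernoulli zero    = ≤-refl
bernoulli (suc m) = begin
  13 * 13 ^ m * (13 + suc m)           ≤⟨ *-monoʳ-≤ (13 * 13 ^ m) (m≤m+n (13 + suc m) 0) ⟩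
  13 * 13 ^ m * (13 + suc m + 0)       ≤⟨ m≤m+n _ (13 ^ m * m) ⟩
  13 * 13 ^ m * (13 + suc m + 0) + 13 ^ m * m  ≡⟨ regroup (13 ^ m) m ⟩
  14 * (13 ^ m * (13 + m))             ≤⟨ *-monoʳ-≤ 14 (bernoulli m) ⟩
  14 * (13 * 14 ^ m)                   ≡⟨ swap (14 ^ m) ⟩
  13 * (14 * 14 ^ m)                   ∎
  where
  open ≤-Reasoning
  regroup : ∀ x m → 13 * x * (13 + suc m + 0) + x * m ≡ 14 * (x * (13 + m))
  regroup = solve-∀
  swap : ∀ x → 14 * (13 * x) ≡ 13 * (14 * x)
  swap = solve-∀

-- All of 13 e rounds fail with probability at most (13 / 14) to the power 13 e, which is thus at
-- most 1 / (1 + e).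
bernoulli′ : ∀ e → suc e * 13 ^ (13 * e) ≤ 14 ^ (13 * e)
bernoulli′ e = *-cancelˡ-≤ 13 (begin
  13 * (suc e * 13 ^ (13 * e))          ≡⟨ regroup e (13 ^ (13 * e)) ⟩
  13 ^ (13 * e) * (13 + 13 * e)         ≤⟨ bernoulli (13 * e) ⟩
  13 * 14 ^ (13 * e)                    ∎)
  where
  open ≤-Reasoning
  regroup : ∀ e x → 13 * (suc e * x) ≡ x * (13 + 13 * e)
  regroup = solve-∀

2^a≤2*2^b : ∀ a b → ∣ a - b ∣ ≤ 1 → 2 ^ a ≤ 2 * 2 ^ b
2^a≤2*2^b a b close = ^-monoʳ-≤ 2 (begin
  a            ≤⟨ m≤n+m∸n a b ⟩
  b + (a ∸ b)  ≤⟨ +-monoʳ-≤ b (≤-trans (m∸n≤∣m-n∣ a b) close) ⟩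
  b + 1        ≡⟨ +-comm b 1 ⟩
  suc b        ∎)
  where open ≤-Reasoning

module RegularRounds {c ℓ n} (G : FiniteGroup c ℓ n) .{{n≢0 : NonZero n}} {a b : ℕ}
                     (A : Vec (FiniteGroup.Carrier G) a) (B : Vec (FiniteGroup.Carrier G) b)
                     (z : FiniteGroup.Carrier G) (close : ∣ a - b ∣ ≤ 1)
                     (regA : SecondMoment.Regular G A) (regB : SecondMoment.Regular G B) where
  open Rounds G A B z public
  open GroupProperties group
    using (//-rightDividesˡ; \\-leftDividesˡ; \\-leftDividesʳ; ⁻¹-involutive; ⁻¹-anti-homo-∙)

  cs : List C
  cs = 𝒞-elements a b

  ∑-cs : ∀ f → ∑ cs f ≡ ∑[ u ∈ subsets a ] f (inj₁ u) + ∑[ u ∈ subsets b ] f (inj₂ u)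
  ∑-cs f = trans (∑-++ (map inj₁ (subsets a)) (map inj₂ (subsets b)) f)
                 (cong₂ _+_ (∑-map inj₁ (subsets a) f) (∑-map inj₂ (subsets b) f))

  length-cs : length cs ≡ 2 ^ a + 2 ^ b
  length-cs = trans (length-++ (map inj₁ (subsets a)))
    (cong₂ _+_ (trans (length-map inj₁ (subsets a)) (length-subsets a))
               (trans (length-map inj₂ (subsets b)) (length-subsets b)))

  cs≢[] : NonZero (length cs)
  cs≢[] = >-nonZero (≤-trans (m^n>0 2 a) (≤-trans (m≤m+n _ (2 ^ b)) (≤-reflexive (sym length-cs))))

  countA countB : C → ℕ
  countA v = representations A (value v)
  countB v = representations B (value v ⁻¹ ∙ z)

  match-A : ∀ v u → 𝟙 (match v (inj₁ u)) ≡ δ (π (subsequence A u)) (value v)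
  match-A v u = δ-sym (value v) (π (subsequence A u))

  match-B : ∀ v u → 𝟙 (match v (inj₂ u)) ≡ δ (π (subsequence B u)) (value v ⁻¹ ∙ z)
  match-B v u = δ-⇔ solve₁ solve₂
    where
    g p : Carrier
    g = value v
    p = π (subsequence B u)
    solve₁ : g ≈ z ∙ p ⁻¹ → p ≈ g ⁻¹ ∙ z
    solve₁ eq = ≈-trans (≈-sym (\\-leftDividesʳ g p)) (∙-congˡ (≈-trans (∙-congʳ eq) (//-rightDividesˡ p z)))
    solve₂ : p ≈ g ⁻¹ ∙ z → g ≈ z ∙ p ⁻¹
    solve₂ eq = ≈-sym (≈-trans (∙-congˡ (≈-trans (⁻¹-cong eq) (⁻¹-anti-homo-∙ (g ⁻¹) z)))
      (≈-trans (\\-leftDividesˡ z (g ⁻¹ ⁻¹)) (⁻¹-involutive g)))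

  matches : ∀ v → ∑[ d ∈ cs ] 𝟙 (match v d) ≡ countA v + countB v
  matches v = trans (∑-cs _) (cong₂ _+_ (∑-cong (subsets a) (match-A v)) (∑-cong (subsets b) (match-B v)))

  ∑-never : ∀ {X : Set} (xs : List X) (P : X → Bool) → ∑[ x ∈ xs ] 𝟙 (P x ∧ false) ≡ 0
  ∑-never xs P = trans (∑-cong xs (λ x → cong 𝟙 (∧-zeroʳ (P x)))) (trans (∑-const xs 0) (*-zeroʳ (length xs)))

  opposite-matches-A : ∀ u → ∑[ d ∈ cs ] 𝟙 (match (inj₁ u) d ∧ opposite (inj₁ u) d) ≡ countB (inj₁ u)
  opposite-matches-A u = trans (∑-cs _) (cong₂ _+_ (∑-never (subsets a) (λ d → match (inj₁ u) (inj₁ d)))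
    (∑-cong (subsets b) (λ d → trans (cong 𝟙 (∧-identityʳ _)) (match-B (inj₁ u) d))))

  opposite-matches-B : ∀ u → ∑[ d ∈ cs ] 𝟙 (match (inj₂ u) d ∧ opposite (inj₂ u) d) ≡ countA (inj₂ u)
  opposite-matches-B u = trans (∑-cs _) (trans (cong₂ _+_
    (∑-cong (subsets a) (λ d → trans (cong 𝟙 (∧-identityʳ _)) (match-A (inj₂ u) d)))
    (∑-never (subsets b) (λ d → match (inj₂ u) (inj₂ d)))) (+-identityʳ _))

  frequent : ∀ v → length cs ≤ 2 * n * ∑[ d ∈ cs ] 𝟙 (match v d)
  frequent v = begin
    length cs                             ≡⟨ length-cs ⟩
    2 ^ a + 2 ^ b                         ≤⟨ +-mono-≤ (proj₁ (regular⇒balanced A regA (value v)))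
                                                      (proj₁ (regular⇒balanced B regB (value v ⁻¹ ∙ z))) ⟩
    2 * (n * countA v) + 2 * (n * countB v) ≡⟨ regroup n (countA v) (countB v) ⟩
    2 * n * (countA v + countB v)         ≡⟨ cong (2 * n *_) (matches v) ⟨
    2 * n * ∑[ d ∈ cs ] 𝟙 (match v d)     ∎
    where
    open ≤-Reasoning
    regroup : ∀ n x y → 2 * (n * x) + 2 * (n * y) ≡ 2 * n * (x + y)
    regroup = solve-∀

  -- The counts lie between 1 / 2 and 3 / 2 of their means, and the first mean is at most twice the
  -- second: the ratio is at most 3 · 2. Hence each half has a share of at least 1 / 7 in every
  -- label.
  balanced-≤ : ∀ {a b} (A : Vec Carrier a) (B : Vec Carrier b) {g h} → Balanced A g → Balanced B h →
               2 ^ a ≤ 2 * 2 ^ b → representations A g ≤ 6 * representations B h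
  balanced-≤ {a} {b} A B {g} {h} (_ , A≤) (B≥ , _) α≤2β = *-cancelˡ-≤ (2 * n) {{m*n≢0 2 n}} (begin
    2 * n * r          ≡⟨ *-assoc 2 n r ⟩
    2 * (n * r)        ≤⟨ A≤ ⟩
    3 * 2 ^ a          ≤⟨ *-monoʳ-≤ 3 α≤2β ⟩
    3 * (2 * 2 ^ b)    ≤⟨ *-monoʳ-≤ 3 (*-monoʳ-≤ 2 B≥) ⟩
    3 * (2 * (2 * (n * r′))) ≡⟨ regroup n r′ ⟩
    2 * n * (6 * r′)   ∎)
    where
    open ≤-Reasoning
    r r′ : ℕ
    r  = representations A g
    r′ = representations B h
    regroup : ∀ n r → 3 * (2 * (2 * (n * r))) ≡ 2 * n * (6 * r)
    regroup = solve-∀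

  useful : ∀ v → ∑[ d ∈ cs ] 𝟙 (match v d) ≤ 7 * ∑[ d ∈ cs ] 𝟙 (match v d ∧ opposite v d)
  useful v@(inj₁ u) = begin
    ∑[ d ∈ cs ] 𝟙 (match v d)    ≡⟨ matches v ⟩
    countA v + countB v          ≤⟨ +-monoˡ-≤ (countB v) (balanced-≤ A B (regular⇒balanced A regA _)
                                      (regular⇒balanced B regB _) (2^a≤2*2^b a b close)) ⟩
    6 * countB v + countB v      ≡⟨ +-comm (6 * countB v) _ ⟩
    7 * countB v                 ≡⟨ cong (7 *_) (opposite-matches-A u) ⟨
    7 * ∑[ d ∈ cs ] 𝟙 (match v d ∧ opposite v d) ∎
    where open ≤-Reasoning
  useful v@(inj₂ u) = begin
    ∑[ d ∈ cs ] 𝟙 (match v d)    ≡⟨ matches v ⟩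
    countA v + countB v          ≤⟨ +-monoʳ-≤ (countA v) (balanced-≤ B A (regular⇒balanced B regB _)
                                      (regular⇒balanced A regA _)
                                      (2^a≤2*2^b b a (≤-trans (≤-reflexive (∣-∣-comm b a)) close))) ⟩
    countA v + 6 * countA v      ≡⟨⟩
    7 * countA v                 ≡⟨ cong (7 *_) (opposite-matches-B u) ⟨
    7 * ∑[ d ∈ cs ] 𝟙 (match v d ∧ opposite v d) ∎
    where open ≤-Reasoning

  open Average cs {{cs≢[]}}
  open Bounds frequent useful

  Ω : List (Draw n a b)
  Ω = draws n a b

  D : ℕ
  D = length Ω

  D≡ : D ≡ draws#
  D≡ = length-cartesianProductWith _,_ cs (vectors cs n)

  D≢0 : NonZero D
  D≢0 = subst NonZero (sym (trans D≡ (cong (length cs *_) (length-vectors cs n))))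
    (m*n≢0 (length cs) (length cs ^ n) {{cs≢[]}} {{m^n≢0 (length cs) n {{cs≢[]}}}})

  fails : Draw n a b → ℕ
  fails d = 1 ∸ successes d

  F : ℕ
  F = ∑ Ω fails

  fails-≤ : 14 * F ≤ 13 * D
  fails-≤ = +-cancelʳ-≤ (14 * ∑ Ω successes) _ _ (begin
    14 * F + 14 * ∑ Ω successes
      ≡⟨ *-distribˡ-+ 14 F _ ⟨
    14 * (F + ∑ Ω successes)
      ≡⟨ cong (14 *_) (trans (sym (∑-+ Ω fails successes))
           (trans (∑-cong Ω (λ (w , η) → m∸n+n≡m (success≤1 n [] w η)))
                  (trans (∑-const Ω 1) (*-identityʳ D)))) ⟩
    14 * D
      ≡⟨ +-comm D (13 * D) ⟩
    13 * D + D
      ≤⟨ +-monoʳ-≤ (13 * D) (begin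
           D                          ≡⟨ D≡ ⟩
           draws#                     ≤⟨ success-≥ n [] _ (+-identityʳ n) ⟩
           14 * total (λ V d → 𝟙 (good V d)) 0 n []
                                      ≡⟨ cong (14 *_) (∑-cartesianProductWith _,_ cs (vectors cs n) successes) ⟨
           14 * ∑ Ω successes         ∎) ⟩
    13 * D + 14 * ∑ Ω successes ∎)
    where open ≤-Reasoning

  ∑-failures : ∀ m → ∑ (vectors Ω m) failures ≡ F ^ m
  ∑-failures zero    = refl
  ∑-failures (suc m) = begin
    ∑ (vectors Ω (suc m)) failures
      ≡⟨ ∑-vectors Ω m failures ⟩
    ∑[ d ∈ Ω ] ∑[ ds ∈ vectors Ω m ] (fails d * failures ds)
      ≡⟨ ∑-cong Ω (λ d → trans (∑-*ˡ (fails d) (vectors Ω m) failures) (cong (fails d *_) (∑-failures m))) ⟩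
    ∑[ d ∈ Ω ] (fails d * F ^ m)
      ≡⟨ ∑-*ʳ (F ^ m) Ω fails ⟩
    F ^ suc m ∎
    where open ≡-Reasoning

  output? : ∀ C → Dec (∃[ u ] C ≡ output u)
  output? restart              = no λ ()
  output? (evaluate _ _ _ _)   = no λ ()
  output? (multiply _ _ _ _ _) = no λ ()
  output? (output u)           = yes (u , refl)

  terminating : ∀ e → ∃₂ λ m t →
    HoldsUpTo1/1+ e (vectors Ω m) (λ ds → ∃[ u ] configuration t ds ≡ output u)
  terminating e = m , m * roundBound ,
    HoldsUpTo-from-bad (λ ds → output? (configuration (m * roundBound) ds)) e (vectors Ω m) failures
      (λ ds ¬out → [ (λ out → contradiction out ¬out) , (λ fail → fail) ]′
                     (run-ends (m * roundBound) ds ≤-refl))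
      (*-cancelˡ-≤ (14 ^ m) {{m^n≢0 14 m}} (begin
        14 ^ m * (suc e * ∑ (vectors Ω m) failures) ≡⟨ cong (λ f → 14 ^ m * (suc e * f)) (∑-failures m) ⟩
        14 ^ m * (suc e * F ^ m)          ≡⟨ regroup₁ (14 ^ m) (suc e) (F ^ m) ⟩
        suc e * (14 ^ m * F ^ m)          ≡⟨ cong (suc e *_) (^-distribʳ-* 14 F m) ⟨
        suc e * (14 * F) ^ m              ≤⟨ *-monoʳ-≤ (suc e) (^-monoˡ-≤ m fails-≤) ⟩
        suc e * (13 * D) ^ m              ≡⟨ cong (suc e *_) (^-distribʳ-* 13 D m) ⟩
        suc e * (13 ^ m * D ^ m)          ≡⟨ *-assoc (suc e) (13 ^ m) (D ^ m) ⟨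
        suc e * 13 ^ m * D ^ m            ≤⟨ *-monoˡ-≤ (D ^ m) (bernoulli′ e) ⟩
        14 ^ m * D ^ m                    ≡⟨ cong (14 ^ m *_) (length-vectors Ω m) ⟨
        14 ^ m * length (vectors Ω m)     ∎))
    where
    open ≤-Reasoning
    m : ℕ
    m = 13 * e
    regroup₁ : ∀ x y w → x * (y * w) ≡ y * (x * w)
    regroup₁ = solve-∀

  W : ℕ
  W = ∑ Ω steps

  -- If a round takes W / D steps on average and fails with probability at most 13 / 14, a total T
  -- with T ≤ W / D + (13 / 14) T is at most 14 W / D. The induction on the draws leaves `t` free,
  -- as the fuel remaining after a round varies with its draw.
  ∑-operations : ∀ m t → D * ∑ (vectors Ω m) (operations t) ≤ 14 * W * length (vectors Ω m)
  ∑-operations zero    zero    = ≤-trans (≤-reflexive (*-zeroʳ D)) z≤n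
  ∑-operations zero    (suc t) = ≤-trans (≤-reflexive (*-zeroʳ D)) z≤n
  ∑-operations (suc m) t = begin
    D * ∑ (vectors Ω (suc m)) (operations t)
      ≡⟨ cong (D *_) (∑-vectors Ω m (operations t)) ⟩
    D * ∑[ d ∈ Ω ] ∑[ ds ∈ Ωᵐ ] operations t (d ∷ ds)
      ≡⟨ ∑-*ˡ D Ω _ ⟨
    ∑[ d ∈ Ω ] (D * ∑[ ds ∈ Ωᵐ ] operations t (d ∷ ds))
      ≤⟨ ∑-mono Ω first ⟩
    ∑[ d ∈ Ω ] (steps d * (D * L) + fails d * (14 * W * L))
      ≡⟨ trans (∑-+ Ω _ _) (cong₂ _+_ (∑-*ʳ (D * L) Ω steps) (∑-*ʳ (14 * W * L) Ω fails)) ⟩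
    W * (D * L) + F * (14 * W * L)
      ≡⟨ regroup₁ W D L F ⟩
    W * (D * L) + 14 * F * (W * L)
      ≤⟨ +-monoʳ-≤ (W * (D * L)) (*-monoˡ-≤ (W * L) fails-≤) ⟩
    W * (D * L) + 13 * D * (W * L)
      ≡⟨ regroup₂ W D L ⟩
    14 * W * (D * L)
      ≡⟨ cong (14 * W *_) (length-cartesianProductWith _∷_ Ω Ωᵐ) ⟨
    14 * W * length (vectors Ω (suc m)) ∎
    where
    open ≤-Reasoning
    Ωᵐ = vectors Ω m
    L = length Ωᵐ
    regroup₁ : ∀ W D L F → W * (D * L) + F * (14 * W * L) ≡ W * (D * L) + 14 * F * (W * L)
    regroup₁ = solve-∀
    regroup₂ : ∀ W D L → W * (D * L) + 13 * D * (W * L) ≡ 14 * W * (D * L)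
    regroup₂ = solve-∀
    regroup₃ : ∀ D L s f T → D * (L * s + f * T) ≡ s * (D * L) + f * (D * T)
    regroup₃ = solve-∀
    first : ∀ d → D * ∑[ ds ∈ Ωᵐ ] operations t (d ∷ ds) ≤ steps d * (D * L) + fails d * (14 * W * L)
    first d with t′ , ops≤ ← run-operations t d = begin
      D * ∑[ ds ∈ Ωᵐ ] operations t (d ∷ ds)
        ≤⟨ *-monoʳ-≤ D (∑-mono Ωᵐ (λ ds → ops≤ ds)) ⟩
      D * ∑[ ds ∈ Ωᵐ ] (steps d + fails d * operations t′ ds)
        ≡⟨ cong (D *_) (trans (∑-+ Ωᵐ _ _)
             (cong₂ _+_ (∑-const Ωᵐ (steps d)) (∑-*ˡ (fails d) Ωᵐ (operations t′)))) ⟩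
      D * (L * steps d + fails d * ∑ Ωᵐ (operations t′))
        ≡⟨ regroup₃ D L (steps d) (fails d) _ ⟩
      steps d * (D * L) + fails d * (D * ∑ Ωᵐ (operations t′))
        ≤⟨ +-monoʳ-≤ (steps d * (D * L)) (*-monoʳ-≤ (fails d) (∑-operations m t′)) ⟩
      steps d * (D * L) + fails d * (14 * W * L) ∎

  module Time (s : ℕ) .{{s≢0 : NonZero s}} (n≤s² : n ≤ s * s) where

    -- A draw takes M (8 T + 13) steps, where the duration T averages at most 3 s; so 24 s + 13 s.
    -- The factor 14 for the number of rounds then gives 518.
    W-≤ : W ≤ M * (37 * s) * D
    W-≤ = begin
      W
        ≡⟨ ∑-cong Ω (λ (w , η) → regroup₁ M (duration n [] w η)) ⟩
      ∑[ d ∈ Ω ] (M * 8 * duration n [] (proj₁ d) (proj₂ d) + M * 13)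
        ≡⟨ trans (∑-+ Ω _ _) (cong₂ _+_ (∑-*ˡ (M * 8) Ω _) (∑-const Ω (M * 13))) ⟩
      M * 8 * ∑[ d ∈ Ω ] duration n [] (proj₁ d) (proj₂ d) + D * (M * 13)
        ≡⟨ cong (λ t → M * 8 * t + D * (M * 13)) (∑-cartesianProductWith _,_ cs (vectors cs n) _) ⟩
      M * 8 * total (λ _ _ → 0) 1 n [] + D * (M * 13)
        ≤⟨ +-mono-≤ (*-monoʳ-≤ (M * 8) (duration-≤ s n≤s² n [] _))
                    (*-monoʳ-≤ D (*-monoʳ-≤ M (m≤m*n 13 s))) ⟩
      M * 8 * ((2 * s + s) * draws#) + D * (M * (13 * s))
        ≡⟨ cong (λ t → M * 8 * ((2 * s + s) * t) + D * (M * (13 * s))) D≡ ⟨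
      M * 8 * ((2 * s + s) * D) + D * (M * (13 * s))
        ≡⟨ regroup₂ M s D ⟩
      M * (37 * s) * D ∎
      where
      open ≤-Reasoning
      regroup₁ : ∀ M t → M * (8 * suc t + 5) ≡ M * 8 * t + M * 13
      regroup₁ = solve-∀
      regroup₂ : ∀ M s D → M * 8 * ((2 * s + s) * D) + D * (M * (13 * s)) ≡ M * (37 * s) * D
      regroup₂ = solve-∀

    expected-operations : ∀ m t → ∑ (vectors Ω m) (operations t) ≤ 518 * M * s * length (vectors Ω m)
    expected-operations m t = *-cancelˡ-≤ D {{D≢0}} (begin
      D * ∑ (vectors Ω m) (operations t)      ≤⟨ ∑-operations m t ⟩
      14 * W * L                              ≤⟨ *-monoˡ-≤ L (*-monoʳ-≤ 14 W-≤) ⟩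
      14 * (M * (37 * s) * D) * L             ≡⟨ regroup M s D L ⟩
      D * (518 * M * s * L)                   ∎)
      where
      open ≤-Reasoning
      L = length (vectors Ω m)
      regroup : ∀ M s D L → 14 * (M * (37 * s) * D) * L ≡ D * (518 * M * s * L)
      regroup = solve-∀

-- Solving every target for a fixed regular sequence

module _ {c ℓ n} (G : FiniteGroup c ℓ n) where
  open FiniteGroup G using (Carrier; _≈_; _∙_; group)
    renaming (refl to ≈-refl; sym to ≈-sym; trans to ≈-trans; reflexive to ≈-reflexive)
  open FiniteGroup G using (identityˡ; assoc; ∙-congˡ)
  open Products group

  π-++ : ∀ xs ys → π (xs ++ ys) ≈ π xs ∙ π ys
  π-++ []       ys = ≈-sym (identityˡ _)
  π-++ (x ∷ xs) ys = ≈-trans (∙-congˡ (π-++ xs ys)) (≈-sym (assoc x _ _))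

  subsequence-++ : ∀ a {b} (S : Vec Carrier (a + b)) x y →
    subsequence S (x Vec.++ y) ≡ subsequence (take a S) x ++ subsequence (drop a S) y
  subsequence-++ zero    S       []            y = refl
  subsequence-++ (suc a) (g ∷ S) (inside ∷ x)  y = cong (g ∷_) (subsequence-++ a S x y)
  subsequence-++ (suc a) (_ ∷ S) (outside ∷ x) y = subsequence-++ a S x y

  module _ {a b} (close : ∣ a - b ∣ ≤ 1) (S : Vec Carrier (a + b)) (z : Carrier)
           (regA : SecondMoment.Regular G (take a S)) (regB : SecondMoment.Regular G (drop a S))
           (k : ℕ) {s : ℕ} (2≤n : 2 ≤ n) (a+b≤ : a + b ≤ k * ⌊log₂ n ⌋)
           (1≤L : 1 ≤ ⌊log₂ n ⌋) (L≤Λ : ⌊log₂ n ⌋ ≤ ⌈log₂ n ⌉)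
           (1≤s : 1 ≤ s) (n≤s² : n ≤ s * s) (s²≤4n : s * s ≤ 4 * n) where
    private
      instance
        n≢0 : NonZero n
        n≢0 = >-nonZero (<⇒≤ 2≤n)
        s≢0 : NonZero s
        s≢0 = >-nonZero 1≤s
    open RegularRounds G (take a S) (drop a S) z close regA regB
      using (Ω; M; Solution; configuration; operations; counterBound; storageBound;
             run-acceptable; terminating; module Time)

    pollardSolves : PollardSolves (1036 * (2 * k + 1)) (4 * k + 10) G a b S z
    pollardSolves = record
      { correct    = λ t ds u eq → correct (proj₂ (run-acceptable t ds) u eq)
      ; terminates = terminating
      ; time       = time
      ; space      = λ t ds → ≤-trans (proj₁ (run-acceptable t ds)) space
      }
      where
      L Λ : ℕ
      L = ⌊log₂ n ⌋
      Λ = ⌈log₂ n ⌉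

      correct : ∀ {u} → Solution u → π (subsequence S u) ≈ z
      correct (x , y , refl , eq) =
        ≈-trans (≈-reflexive (cong π (subsequence-++ a S x y)))
          (≈-trans (π-++ (subsequence (take a S) x) (subsequence (drop a S) y)) eq)

      M≤ : M ≤ (2 * k + 1) * L
      M≤ = begin
        suc ((a + b) + (a + b))        ≤⟨ +-mono-≤ 1≤L (+-mono-≤ a+b≤ a+b≤) ⟩
        L + (k * L + k * L)            ≡⟨ regroup k L ⟩
        (2 * k + 1) * L                ∎
        where
        open ≤-Reasoning
        regroup : ∀ k L → L + (k * L + k * L) ≡ (2 * k + 1) * L
        regroup = solve-∀

      time : ∀ m t → ∑ (vectors Ω m) (operations t) ^ 2 ≤
                     (1036 * (2 * k + 1) * L * length (vectors Ω m)) ^ 2 * n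
      time m t = begin
        ∑ (vectors Ω m) (operations t) ^ 2
          ≤⟨ ^-monoˡ-≤ 2 (Time.expected-operations s n≤s² m t) ⟩
        (518 * M * s * N) ^ 2
          ≤⟨ ^-monoˡ-≤ 2 (*-monoˡ-≤ N (*-monoˡ-≤ s (*-monoʳ-≤ 518 M≤))) ⟩
        (518 * ((2 * k + 1) * L) * s * N) ^ 2
          ≡⟨ regroup₁ (2 * k + 1) L s N ⟩
        518 * (2 * k + 1) * L * N * (518 * (2 * k + 1) * L * N) * (s * s)
          -- As s ≤ 2 √n, the constant 518 doubles to 1036.
          ≤⟨ *-monoʳ-≤ (518 * (2 * k + 1) * L * N * (518 * (2 * k + 1) * L * N)) s²≤4n ⟩
        518 * (2 * k + 1) * L * N * (518 * (2 * k + 1) * L * N) * (4 * n)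
          ≡⟨ regroup₂ (2 * k + 1) L N n ⟩
        (1036 * (2 * k + 1) * L * N) ^ 2 * n ∎
        where
        open ≤-Reasoning
        N = length (vectors Ω m)
        regroup₁ : ∀ q L s N → (518 * (q * L) * s * N) * ((518 * (q * L) * s * N) * 1) ≡
                               518 * q * L * N * (518 * q * L * N) * (s * s)
        regroup₁ = solve-∀
        regroup₂ : ∀ q L N n → 518 * q * L * N * (518 * q * L * N) * (4 * n) ≡
                               (1036 * q * L * N) * ((1036 * q * L * N) * 1) * n
        regroup₂ = solve-∀

      -- The 4 k comes from four terms a + b, each at most k Λ. The 10 comes from three units
      -- rounded up to Λ, two counters of at most 2 Λ each, and three group elements.
      space : storageBound ≤ (4 * k + 10) * Λ
      space = begin
        suc (a + b) + suc (a + b) + (counterBound + counterBound) + Λ + suc (a + b) + (a + b) + (Λ + Λ)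
          ≤⟨ +-monoˡ-≤ (Λ + Λ) (+-mono-≤ (+-mono-≤ (+-monoˡ-≤ Λ
               (+-mono-≤ (+-mono-≤ 1+ 1+) (+-mono-≤ counter counter))) 1+) a+b≤kΛ) ⟩
        (Λ + k * Λ) + (Λ + k * Λ) + ((Λ + Λ) + (Λ + Λ)) + Λ + (Λ + k * Λ) + k * Λ + (Λ + Λ)
          ≡⟨ regroup k Λ ⟩
        (4 * k + 10) * Λ ∎
        where
        open ≤-Reasoning
        1≤Λ = ≤-trans 1≤L L≤Λ
        a+b≤kΛ = ≤-trans a+b≤ (*-monoʳ-≤ k L≤Λ)
        1+ : suc (a + b) ≤ Λ + k * Λ
        1+ = +-mono-≤ 1≤Λ a+b≤kΛ
        counter : counterBound ≤ Λ + Λ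
        counter = begin
          ⌈log₂ 2 + n ⌉   ≤⟨ ⌈log₂⌉-mono-≤ (≤-trans (+-monoˡ-≤ n 2≤n)
                               (≤-reflexive (cong (n +_) (sym (+-identityʳ n))))) ⟩
          ⌈log₂ 2 * n ⌉   ≡⟨ ⌈log₂2*n⌉≡1+⌈log₂n⌉ n ⟩
          1 + Λ           ≤⟨ +-monoˡ-≤ Λ 1≤Λ ⟩
          Λ + Λ           ∎
        regroup : ∀ k Λ →
          (Λ + k * Λ) + (Λ + k * Λ) + ((Λ + Λ) + (Λ + Λ)) + Λ + (Λ + k * Λ) + k * Λ + (Λ + Λ) ≡
          (4 * k + 10) * Λ
        regroup = solve-∀

-- Logarithms

open import Data.Integer.Base as ℤ using (+_; -[1+_])
import Data.Integer.Properties as ℤ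
open import Data.Rational.Base as ℚ using (mkℚ; ↥_; ↧ₙ_; _/_)
import Data.Rational.Properties as ℚ
open import Data.Rational.Unnormalised.Base using (mkℚᵘ)
import Data.Rational.Unnormalised.Properties as ℚᵘ

lower<upper : ∀ (d : ℝ) {q r} → q <ᵣ d → d ᵣ< r → q ℚ.< r
lower<upper d {q} {r} q<d d<r with ℚ.<-cmp q r
... | tri< q<r _ _ = q<r
... | tri≈ _ refl _ = contradiction (q<d , d<r) (ℝ.disjoint d q)
... | tri> _ _ r<q =
  contradiction (Equivalence.from (ℝ.lower-rounded d r) (q , r<q , q<d) , d<r) (ℝ.disjoint d r)

-- The comparison excludes a negative numerator, so that r becomes a quotient of natural numbers
-- that can serve in exponents.
fraction-< : ∀ p q r → (+ p) / suc q ℚ.< r → ∃[ m ] ↥ r ≡ + m × p * ↧ₙ r < m * suc q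
fraction-< p q r@(mkℚ (+ m) e _) lt = m , refl , ℤ.drop‿+<+
  (subst₂ ℤ._<_ (sym (ℤ.pos-* p (suc e))) (sym (ℤ.pos-* m (suc q)))
  (ℚᵘ.drop-*<* (ℚᵘ.<-respˡ-≃ (ℚ.toℚᵘ-fromℚᵘ (mkℚᵘ (+ p) q)) (ℚ.toℚᵘ-mono-< lt))))
fraction-< p q r@(mkℚ -[1+ m ] e _) lt
  with () ← subst (ℤ._< -[1+ m ] ℤ.* + suc q) (sym (ℤ.pos-* p (suc e)))
              (ℚᵘ.drop-*<* (ℚᵘ.<-respˡ-≃ (ℚ.toℚᵘ-fromℚᵘ (mkℚᵘ (+ p) q)) (ℚ.toℚᵘ-mono-< lt)))

<-fraction : ∀ p q r {m} → ↥ r ≡ + m → r ℚ.< (+ p) / suc q → m * suc q < p * ↧ₙ r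
<-fraction p q r@(mkℚ (+ m) e _) refl lt = ℤ.drop‿+<+
  (subst₂ ℤ._<_ (sym (ℤ.pos-* m (suc q))) (sym (ℤ.pos-* p (suc e)))
  (ℚᵘ.drop-*<* (ℚᵘ.<-respʳ-≃ (ℚ.toℚᵘ-fromℚᵘ (mkℚᵘ (+ p) q)) (ℚ.toℚᵘ-mono-< lt))))

^-cancelˡ-< : ∀ x y m → x ^ m < y ^ m → x < y
^-cancelˡ-< x y m lt = ≰⇒> (λ y≤x → <⇒≱ lt (^-monoˡ-≤ m y≤x))

^-cancelʳ-< : ∀ x .{{_ : NonZero x}} m n → x ^ m < x ^ n → m < n
^-cancelʳ-< x m n lt = ≰⇒> (λ n≤m → <⇒≱ lt (^-monoʳ-≤ x n≤m))

n<2^⌊log₂n⌋+1 : ∀ n → n < 2 ^ suc ⌊log₂ n ⌋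
n<2^⌊log₂n⌋+1 n = ≰⇒> (λ 2^≤n → <⇒≱ (n<1+n ⌊log₂ n ⌋)
  (≤-trans (≤-reflexive (sym (⌊log₂[2^n]⌋≡n (suc ⌊log₂ n ⌋)))) (⌊log₂⌋-mono-≤ 2^≤n)))

2^⌊log₂n⌋≤n : ∀ n → 1 ≤ n → 2 ^ ⌊log₂ n ⌋ ≤ n
2^⌊log₂n⌋≤n n 1≤n = go ⌊log₂ n ⌋ n 1≤n refl
  where
  go : ∀ l n → 1 ≤ n → ⌊log₂ n ⌋ ≡ l → 2 ^ l ≤ n
  go zero    n               1≤n _  = 1≤n
  go (suc l) 1               1≤n ()
  go (suc l) n@(suc (suc _)) 1≤n eq = begin
    2 * 2 ^ l                ≤⟨ *-monoʳ-≤ 2 (go l ⌊ n /2⌋ (s≤s z≤n)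
                                  (trans (⌊log₂⌊n/2⌋⌋≡⌊log₂n⌋∸1 n) (cong (_∸ 1) eq))) ⟩
    2 * ⌊ n /2⌋              ≡⟨ cong (λ t → ⌊ n /2⌋ + t) (+-identityʳ ⌊ n /2⌋) ⟩
    ⌊ n /2⌋ + ⌊ n /2⌋        ≤⟨ +-monoʳ-≤ ⌊ n /2⌋ (⌊n/2⌋≤⌈n/2⌉ n) ⟩
    ⌊ n /2⌋ + ⌈ n /2⌉        ≡⟨ ⌊n/2⌋+⌈n/2⌉≡n n ⟩
    n                        ∎
    where open ≤-Reasoning

⌊log₂n⌋≤⌈log₂n⌉ : ∀ n → 1 ≤ n → ⌊log₂ n ⌋ ≤ ⌈log₂ n ⌉
⌊log₂n⌋≤⌈log₂n⌉ n 1≤n =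
  ≤-trans (≤-reflexive (sym (⌈log₂2^n⌉≡n ⌊log₂ n ⌋))) (⌈log₂⌉-mono-≤ (2^⌊log₂n⌋≤n n 1≤n))

1≤⌊log₂n⌋ : ∀ n → 2 ≤ n → 1 ≤ ⌊log₂ n ⌋
1≤⌊log₂n⌋ n 2≤n = ≤-trans (≤-reflexive (sym (⌊log₂[2^n]⌋≡n 1))) (⌊log₂⌋-mono-≤ 2≤n)

-- Going from n to n + 1, s is increased only when it has become too small. In that case s² ≤ n, so
-- (s + 1)² ≤ 3 n + 1.
√-bounds : ∀ n → 1 ≤ n → ∃[ s ] 1 ≤ s × n ≤ s * s × s * s ≤ 4 * n
√-bounds 1 _ = 1 , ≤-refl , ≤-refl , s≤s z≤n
√-bounds (suc n@(suc _)) _ with √-bounds n (s≤s z≤n)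
... | s , 1≤s , n≤s² , s²≤4n with suc n ≤? s * s
...   | yes n<s² = s , 1≤s , n<s² , ≤-trans s²≤4n (*-monoʳ-≤ 4 (n≤1+n n))
...   | no  n≮s² = suc s , s≤s z≤n , large , small
  where
  s²≤n : s * s ≤ n
  s²≤n = s≤s⁻¹ (≰⇒> n≮s²)
  expand : ∀ s → suc s * suc s ≡ suc (s * s + 2 * s)
  expand = solve-∀
  large : suc n ≤ suc s * suc s
  large = ≤-trans (s≤s (≤-trans n≤s² (m≤m+n _ (2 * s)))) (≤-reflexive (sym (expand s)))
  small : suc s * suc s ≤ 4 * suc n
  small = begin
    suc s * suc s              ≡⟨ expand s ⟩
    suc (s * s + 2 * s)        ≤⟨ s≤s (+-monoʳ-≤ (s * s) (*-monoʳ-≤ 2 (m≤m*n s s {{>-nonZero 1≤s}}))) ⟩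
    suc (s * s + 2 * (s * s))  ≤⟨ s≤s (+-mono-≤ s²≤n (*-monoʳ-≤ 2 s²≤n)) ⟩
    suc (n + 2 * n)            ≤⟨ m≤m+n _ (n + 3) ⟩
    suc (n + 2 * n) + (n + 3)  ≡⟨ regroup n ⟩
    4 * suc n                  ∎
    where
    open ≤-Reasoning
    regroup : ∀ n → suc (n + 2 * n) + (n + 3) ≡ 4 * suc n
    regroup = solve-∀

module _ {d : ℝ} where

  -- The numerator m of e is an integer above d, so 2ᵏ < 2 nᵐ; and log₂ n < ⌊log₂ n⌋ + 1 ≤ 2 ⌊log₂
  -- n⌋ as n ≥ 2.
  length-≤-log : ∀ {e} → d ᵣ< e → ∀ {k n} → 2 ≤ n → k ≈ d log₂ n → k ≤ 2 * ℤ.∣ ↥ e ∣ * ⌊log₂ n ⌋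
  length-≤-log {e} d<e {k} {n} 2≤n ((p , q , p/q<d , 2^kQ<) , _)
    with m , eq , p*e<m*Q ← fraction-< p q e (lower<upper d p/q<d d<e) = begin
      k                          ≤⟨ s≤s⁻¹ (^-cancelʳ-< 2 k (suc (suc L * m)) (<-≤-trans 2^k< 2n^m≤)) ⟩
      suc L * m                  ≤⟨ *-monoˡ-≤ m (+-monoˡ-≤ L (1≤⌊log₂n⌋ n 2≤n)) ⟩
      (L + L) * m                ≡⟨ regroup L m ⟩
      2 * m * L                  ≡⟨ cong (λ i → 2 * ℤ.∣ i ∣ * L) eq ⟨
      2 * ℤ.∣ ↥ e ∣ * L          ∎
    where
    open ≤-Reasoning
    L Q : ℕ
    L = ⌊log₂ n ⌋
    Q = suc q
    regroup : ∀ L m → (L + L) * m ≡ 2 * m * L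
    regroup = solve-∀
    p≤m*Q : p ≤ m * Q
    p≤m*Q = ≤-trans (m≤m*n p (↧ₙ e)) (<⇒≤ p*e<m*Q)
    2^k< : 2 ^ k < 2 * n ^ m
    2^k< = ^-cancelˡ-< (2 ^ k) (2 * n ^ m) Q (begin-strict
      (2 ^ k) ^ Q           ≡⟨ ^-*-assoc 2 k Q ⟩
      2 ^ (k * Q)           <⟨ 2^kQ< ⟩
      2 ^ Q * n ^ p         ≤⟨ *-monoʳ-≤ (2 ^ Q) (^-monoʳ-≤ n {{>-nonZero (<⇒≤ 2≤n)}} p≤m*Q) ⟩
      2 ^ Q * n ^ (m * Q)   ≡⟨ cong (2 ^ Q *_) (^-*-assoc n m Q) ⟨
      2 ^ Q * (n ^ m) ^ Q   ≡⟨ ^-distribʳ-* 2 (n ^ m) Q ⟨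
      (2 * n ^ m) ^ Q       ∎)
    2n^m≤ : 2 * n ^ m ≤ 2 ^ suc (suc L * m)
    2n^m≤ = *-monoʳ-≤ 2 (begin
      n ^ m                 ≤⟨ ^-monoˡ-≤ m (<⇒≤ (n<2^⌊log₂n⌋+1 n)) ⟩
      (2 ^ suc L) ^ m       ≡⟨ ^-*-assoc 2 (suc L) m ⟩
      2 ^ (suc L * m)       ∎)

  -- A rational f = m / M with 4 < f < d has m ≥ 4 M + 1, so that n grows
  -- faster than any constant raised to the power M.
  half-length-≥-log : ∀ {f} → (+ 4) / 1 ℚ.< f → f <ᵣ d → ∀ X {n a k} → 2 ≤ n → (4 * (X * X)) ^ ↧ₙ f ≤ n →
    k ≈ d log₂ n → suc k ≤ 2 * suc a → X * (n * n) ≤ 2 ^ a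
  half-length-≥-log {f} 4<f f<d X {n} {a} {k} 2≤n big (_ , p , q , d<p/q , n^p<) k≤
    with m , eq , 4*M<m*1 ← fraction-< 4 0 f 4<f = ≮⇒≥ λ 2^a< → <-irrefl refl (begin-strict
      -- If 2ᵃ were less than X n², the spare factor n obtained from m ≥ 4 M + 1 would exceed (4 X²)
      -- to the power M, contrary to `big`.
      n * n ^ (4 * M)                          ≤⟨ n*n^4M≤ ⟩
      2 ^ (suc k * M)                          ≤⟨ ^-monoʳ-≤ 2 (*-monoˡ-≤ M k≤) ⟩
      2 ^ (2 * suc a * M)                      ≡⟨ ^-*-assoc 2 (2 * suc a) M ⟨
      (2 ^ (2 * suc a)) ^ M                    ≡⟨ cong (_^ M) 4^[a+1] ⟩
      (4 * (2 ^ a * 2 ^ a)) ^ M                <⟨ ^-monoˡ-< M (*-monoʳ-< 4 (*-mono-< 2^a< 2^a<)) ⟩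
      (4 * (X * (n * n) * (X * (n * n)))) ^ M  ≡⟨ cong (_^ M) (regroup₂ X n) ⟩
      (4 * (X * X) * n ^ 4) ^ M                ≡⟨ ^-distribʳ-* (4 * (X * X)) (n ^ 4) M ⟩
      (4 * (X * X)) ^ M * (n ^ 4) ^ M          ≤⟨ *-monoˡ-≤ ((n ^ 4) ^ M) big ⟩
      n * (n ^ 4) ^ M                          ≡⟨ cong (n *_) (^-*-assoc n 4 M) ⟩
      n * n ^ (4 * M)                          ∎)
    where
    open ≤-Reasoning
    M Q : ℕ
    M = ↧ₙ f
    Q = suc q
    instance
      n≢0 : NonZero n
      n≢0 = >-nonZero (<⇒≤ 2≤n)
    regroup₁ : ∀ x → 2 * x * (2 * x) ≡ 4 * (x * x)
    regroup₁ = solve-∀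
    regroup₂ : ∀ X n → 4 * (X * (n * n) * (X * (n * n))) ≡ 4 * (X * X) * (n * (n * (n * (n * 1))))
    regroup₂ = solve-∀
    4^[a+1] : 2 ^ (2 * suc a) ≡ 4 * (2 ^ a * 2 ^ a)
    4^[a+1] = trans (cong (λ t → 2 ^ (suc a + t)) (+-identityʳ (suc a)))
      (trans (^-distribˡ-+-* 2 (suc a) (suc a)) (regroup₁ (2 ^ a)))
    exponent : suc (4 * M) * Q ≤ p * M
    exponent = ≤-trans (*-monoˡ-≤ Q (≤-trans 4*M<m*1 (≤-reflexive (*-identityʳ m))))
                       (<⇒≤ (<-fraction p q f eq (lower<upper d f<d d<p/q)))
    n*n^4M≤ : n * n ^ (4 * M) ≤ 2 ^ (suc k * M)
    n*n^4M≤ = <⇒≤ (^-cancelˡ-< (n ^ suc (4 * M)) (2 ^ (suc k * M)) Q (begin-strict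
      (n ^ suc (4 * M)) ^ Q     ≡⟨ ^-*-assoc n (suc (4 * M)) Q ⟩
      n ^ (suc (4 * M) * Q)     ≤⟨ ^-monoʳ-≤ n exponent ⟩
      n ^ (p * M)               ≡⟨ ^-*-assoc n p M ⟨
      (n ^ p) ^ M               <⟨ ^-monoˡ-< M n^p< ⟩
      (2 ^ (suc k * Q)) ^ M     ≡⟨ ^-*-assoc 2 (suc k * Q) M ⟩
      2 ^ (suc k * Q * M)       ≡⟨ cong (2 ^_) (regroup (suc k) Q M) ⟩
      2 ^ (suc k * M * Q)       ≡⟨ ^-*-assoc 2 (suc k * M) Q ⟨
      (2 ^ (suc k * M)) ^ Q     ∎))
      where
      regroup : ∀ k Q M → k * Q * M ≡ k * M * Q
      regroup = solve-∀

-- Almost all sequences are regular; conclusion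

HoldsUpTo-map : ∀ {ℓ p q} {X : Set ℓ} {P : X → Set p} {Q : X → Set q} e {Ω} →
                (∀ {x} → P x → Q x) → HoldsUpTo1/1+ e Ω P → HoldsUpTo1/1+ e Ω Q
HoldsUpTo-map e P⇒Q (E , E⊆Ω , all , large) = E , E⊆Ω , All.map P⇒Q all , large

module _ {c ℓ n} (G : FiniteGroup c ℓ n) .{{n≢0 : NonZero n}} (e : ℕ) where
  open SecondMoment G

  -- In 8 = 4 · 2 the 4 is that of `∑-irregular`, and the 2 leaves half of the permitted failure
  -- probability to each half of S.
  irregular-small : ∀ a → 8 * suc e * (n * n) ≤ 2 ^ a → 2 * suc e * ∑ (sequences a) irregular ≤ n ^ a
  irregular-small a large = *-cancelˡ-≤ (4 * (n * n)) {{m*n≢0 4 (n * n) {{_}} {{m*n≢0 n n}}}} (begin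
    4 * (n * n) * (2 * suc e * I)   ≡⟨ regroup (n * n) (suc e) I ⟩
    8 * suc e * (n * n) * I         ≤⟨ *-monoˡ-≤ I large ⟩
    2 ^ a * I                       ≤⟨ ∑-irregular a ⟩
    4 * (n * n) * n ^ a             ∎)
    where
    open ≤-Reasoning
    I = ∑ (sequences a) irregular
    regroup : ∀ m e I → 4 * m * (2 * e * I) ≡ 8 * e * m * I
    regroup = solve-∀

  mostly-regular : ∀ a b → 8 * suc e * (n * n) ≤ 2 ^ a → 8 * suc e * (n * n) ≤ 2 ^ b →
    HoldsUpTo1/1+ e (sequences (a + b)) (λ S → Regular (take a S) × Regular (drop a S))
  mostly-regular a b largeA largeB =
    HoldsUpTo-from-bad (λ S → regular? (take a S) ×-dec regular? (drop a S)) e (sequences (a + b))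
      (λ S → irregular (take a S) + irregular (drop a S)) bad
      (*-cancelˡ-≤ 2 (begin
        2 * (suc e * ∑[ S ∈ sequences (a + b) ] (irregular (take a S) + irregular (drop a S)))
          ≡⟨ cong (λ t → 2 * (suc e * t)) (∑-vectors-+ elements a b (λ A B → irregular A + irregular B)) ⟩
        2 * (suc e * ∑[ A ∈ sequences a ] ∑[ B ∈ sequences b ] (irregular A + irregular B))
          ≡⟨ cong (λ t → 2 * (suc e * t)) (trans (∑-cong (sequences a) (λ A →
               trans (∑-+ (sequences b) _ _) (cong (_+ IB) (∑-const (sequences b) (irregular A)))))
               (trans (∑-+ (sequences a) _ _)
                 (cong₂ _+_ (∑-*ˡ NB (sequences a) irregular) (∑-const (sequences a) IB)))) ⟩
        2 * (suc e * (NB * IA + NA * IB))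
          ≡⟨ regroup (suc e) NB IA NA IB ⟩
        NB * (2 * suc e * IA) + NA * (2 * suc e * IB)
          ≤⟨ +-mono-≤ (*-monoʳ-≤ NB (irregular-small a largeA)) (*-monoʳ-≤ NA (irregular-small b largeB)) ⟩
        NB * n ^ a + NA * n ^ b
          ≡⟨ cong₂ (λ x y → x * n ^ a + y * n ^ b) (length-sequences b) (length-sequences a) ⟩
        n ^ b * n ^ a + n ^ a * n ^ b
          ≡⟨ double (n ^ a) (n ^ b) ⟩
        2 * (n ^ a * n ^ b)
          ≡⟨ cong (2 *_) (trans (length-sequences (a + b)) (^-distribˡ-+-* n a b)) ⟨
        2 * length (sequences (a + b)) ∎))
    where
    open ≤-Reasoning
    IA IB NA NB : ℕ
    IA = ∑ (sequences a) irregular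
    IB = ∑ (sequences b) irregular
    NA = length (sequences a)
    NB = length (sequences b)
    length-sequences : ∀ a → length (sequences a) ≡ n ^ a
    length-sequences a = trans (length-vectors elements a) (cong (_^ a) length-elements)
    regroup : ∀ e NB IA NA IB → 2 * (e * (NB * IA + NA * IB)) ≡ NB * (2 * e * IA) + NA * (2 * e * IB)
    regroup = solve-∀
    double : ∀ x y → y * x + x * y ≡ 2 * (x * y)
    double = solve-∀
    not-regular : ∀ {a} (A : Vec Carrier a) → ¬ Regular A → 1 ≤ irregular A
    not-regular A ¬reg = ≤-reflexive (cong (λ r → 𝟙 (not r)) (sym (dec-false (regular? A) ¬reg)))
    bad : ∀ S → ¬ (Regular (take a S) × Regular (drop a S)) → 1 ≤ irregular (take a S) + irregular (drop a S)
    bad S ¬both with regular? (take a S)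
    ... | yes regA = m≤n⇒m≤o+n _ (not-regular (drop a S) (λ regB → ¬both (regA , regB)))
    ... | no ¬regA = m≤n⇒m≤n+o _ (not-regular (take a S) ¬regA)

mainTheorem1 : ∀ {c ℓ} (d : ℝ) → ((+ 4) / 1) <ᵣ d →
    ∃[ κ ] ∃[ σ ] ∀ (e : ℕ) → ∃[ N ] ∀ n → N ≤ n →
    (G : FiniteGroup c ℓ n) (a b : ℕ) → ∣ a - b ∣ ≤ 1 → (a + b) ≈ d log₂ n →
    HoldsUpTo1/1+ e (vectors (FiniteGroup.elements G) (a + b))
    (λ S → ∀ z → z ∈π𝒫[ G ] S → PollardSolves κ σ G a b S z)
mainTheorem1 d 4<d
  with r , d<r ← ℝ.upper-inhabited d
     | f , 4<f , f<d ← Equivalence.to (ℝ.lower-rounded d ((+ 4) / 1)) 4<d =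
  -- Both constants come from a rational upper bound r of d and are chosen before e, n and G.
  1036 * (2 * (2 * ℤ.∣ ↥ r ∣) + 1) , 4 * (2 * ℤ.∣ ↥ r ∣) + 10 , λ e →
  -- X is the factor by which 2ᵃ must exceed n² in `irregular-small`. The rational f strictly
  -- between 4 and d turns this into a threshold for n, and the added 2 makes log₂ n at least 1.
  let X = 8 * suc e; N₀ = (4 * (X * X)) ^ ↧ₙ f in
  2 + N₀ , λ n N≤n G a b close k≈ →
  let 2≤n = ≤-trans (m≤m+n 2 N₀) N≤n
      1≤n = <⇒≤ 2≤n
      N₀≤n = ≤-trans (m≤n+m N₀ 2) N≤n
      s , 1≤s , n≤s² , s²≤4n = √-bounds n 1≤n
      largeA = half-length-≥-log {d} 4<f f<d X {a = a} 2≤n N₀≤n k≈ (half a b close)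
      largeB = half-length-≥-log {d} 4<f f<d X {a = b} 2≤n N₀≤n k≈
                 (≤-trans (≤-reflexive (cong suc (+-comm a b)))
                   (half b a (≤-trans (≤-reflexive (∣-∣-comm b a)) close)))
  in HoldsUpTo-map e (λ {S} (regA , regB) z _ →
       pollardSolves G close S z regA regB (2 * ℤ.∣ ↥ r ∣) 2≤n (length-≤-log {d} d<r 2≤n k≈)
         (1≤⌊log₂n⌋ n 2≤n) (⌊log₂n⌋≤⌈log₂n⌉ n 1≤n) 1≤s n≤s² s²≤4n)
       (mostly-regular G {{>-nonZero 1≤n}} e a b largeA largeB)
  where
  half : ∀ a b → ∣ a - b ∣ ≤ 1 → suc (a + b) ≤ 2 * suc a
  half a b close = begin
    suc (a + b)              ≤⟨ s≤s (+-monoʳ-≤ a (≤-trans (m≤n+m∸n b a) (+-monoʳ-≤ a b∸a≤1))) ⟩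
    suc (a + (a + 1))        ≡⟨ regroup a ⟩
    2 * suc a                ∎
    where
    open ≤-Reasoning
    b∸a≤1 : b ∸ a ≤ 1
    b∸a≤1 = ≤-trans (m∸n≤∣m-n∣ b a) (≤-trans (≤-reflexive (∣-∣-comm b a)) close)
    regroup : ∀ a → suc (a + (a + 1)) ≡ 2 * suc a
    regroup = solve-∀
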